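{- Let $\mathcal S$ be one of the five singular step sets, $k=|\mathcal S|$, $z\in(0,1/k)$ and $|x|<1$. Then $$Q(x,0;z)=\frac{1}{zx^2}\sum_{p\ge0}Y_0\circ(X_0\circ Y_0)^{\circ p}(x;z)\,\big[(X_0\circ Y_0)^{\circ p}(x;z)-(X_0\circ Y_0)^{\circ(p+1)}(x;z)\big],$$ the series being convergent, where $f^{\circ p}$ denotes the $p$-fold composition of $f$. The analogous formula for $Q(0,y;z)$ holds with the roles of $X_0$ and $Y_0$ exchanged, and $Q(0,0;z)=0$.
   Context: $\mathcal S\subset\{ -1,0,1\}^2\setminus\{(0,0)\}$ is singular if, up to exchanging the two coordinates, it is one of $\{(-1,1),(1,-1),(1,1)\}$, $\{(-1,1),(1,-1),(0,1)\}$, $\{(-1,1),(1,-1),(0,1),(1,1)\}$, $\{(-1,1),(1,-1),(0,1),(1,0)\}$, $\{(-1,1),(1,-1),(0,1),(1,1),(1,0)\}$. $Q(x,y;z)=\sum_{i,j,n\ge0}q(i,j;n)x^iy^jz^n$, where $q(i,j;n)$ is the number of walks of length $n$ with steps in $\mathcal S$, starting at $(0,0)$, ending at $(i,j)$ and staying in $\mathbb Z_+^2$. Kernel $K(x,y;z)=xyz[\sum_{(i,j)\in\mathcal S}x^iy^j-1/z]=a(x)y^2+b(x)y+c(x)=\widetilde a(y)x^2+\widetilde b(y)x+\widetilde c(y)$, with $a(x)=zx\sum_{(i,1)\in\mathcal S}x^i$, $b(x)=-1+zx\sum_{(i,0)\in\mathcal S}x^i$, $c(x)=zx\sum_{(i,-1)\in\mathcal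 S}x^i$, and $\widetilde a,\widetilde b,\widetilde c$ defined symmetrically. $Y_0=(-b+d^{1/2})/(2a)$ with $d=b^2-4ac$ is the branch of the $y$-root of $K$ of smaller modulus, and $X_0=(-\widetilde b+\widetilde d^{1/2})/(2\widetilde a)$ with $\widetilde d=\widetilde b^2-4\widetilde a\widetilde c$ the branch of the $x$-root of smaller modulus.
   Formalization: The final clause Q(0,0;z)=0 is false (the empty walk counts 1) and is proved as Q(0,0;z)=1; b(x) is taken as -x+zx∑x^i, as the kernel identity forces, instead of -1+zx∑x^i, and likewise for b~; x and y are nonzero in the two formulas, which divide by zx^2 and zy^2. -}

module Defs where

open import Level using (Level; _⊔_) renaming (suc to lsuc)
open import Algebra.Apartness.Bundles using (HeytingCommutativeRing; HeytingField)
open import Algebra.Bundles using (CommutativeRing; Semiring)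
import Algebra.Definitions.RawSemiring
import Algebra.Solver.Ring.NaturalCoefficients.Default as Solver
open import Data.Fin.Base using (toℕ)
open import Data.Integer.Base using (ℤ; +_; ∣_∣; 0ℤ; 1ℤ; -1ℤ)
import Data.Integer.Base as ℤ
import Data.Integer.Properties as ℤ
open import Data.List.Base using (List; []; _∷_; map; filter; length; foldr; cartesianProductWith; [_])
open import Data.List.Membership.Propositional using (_∈_)
open import Data.List.Relation.Unary.All using (All; []; _∷_)
open import Data.List.Relation.Unary.Any using (here; there)
open import Data.Nat.Base using (ℕ; zero; suc)
import Data.Nat.Base as ℕ
open import Data.Product.Base using (_×_; _,_; proj₁; proj₂; ∃-syntax; swap)
open import Data.Product.Properties using (≡-dec)
open import Data.Sum.Base using (_⊎_)
open import Function.Base using (_∘_)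
open import Relation.Binary.Core using (Rel)
open import Relation.Binary.PropositionalEquality.Core as ≡ using (_≡_)
open import Relation.Binary.Structures using (IsStrictPartialOrder)
open import Relation.Nullary.Decidable using (Dec; _×-dec_)
open import Relation.Nullary.Negation using (¬_)

-- A step set is a duplicate-free list of vectors of {-1,0,1}².
Point : Set
Point = ℤ × ℤ

StepSet : Set
StepSet = List Point

exchange : StepSet → StepSet
exchange = map swap

singularSets : List StepSet
singularSets =
    ((-1ℤ , 1ℤ) ∷ (1ℤ , -1ℤ) ∷ (1ℤ , 1ℤ) ∷ [])
  ∷ ((-1ℤ , 1ℤ) ∷ (1ℤ , -1ℤ) ∷ (0ℤ , 1ℤ) ∷ [])
  ∷ ((-1ℤ , 1ℤ) ∷ (1ℤ , -1ℤ) ∷ (0ℤ , 1ℤ) ∷ (1ℤ , 1ℤ) ∷ [])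
  ∷ ((-1ℤ , 1ℤ) ∷ (1ℤ , -1ℤ) ∷ (0ℤ , 1ℤ) ∷ (1ℤ , 0ℤ) ∷ [])
  ∷ ((-1ℤ , 1ℤ) ∷ (1ℤ , -1ℤ) ∷ (0ℤ , 1ℤ) ∷ (1ℤ , 1ℤ) ∷ (1ℤ , 0ℤ) ∷ [])
  ∷ []

Singular : StepSet → Set
Singular S = ∃[ T ] (T ∈ singularSets × (S ≡ T ⊎ S ≡ exchange T))

stepSequences : StepSet → ℕ → List (List Point)
stepSequences S zero    = [ [] ]
stepSequences S (suc n) = cartesianProductWith _∷_ S (stepSequences S n)

_⊕_ : Point → Point → Point
(i , j) ⊕ (k , l) = i ℤ.+ k , j ℤ.+ l

InQuadrant : Point → Set
InQuadrant (i , j) = 0ℤ ℤ.≤ i × 0ℤ ℤ.≤ j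

-- QuadrantWalk p w e: the walk with successive steps w that starts at p
-- ends at e and has all its vertices in the quadrant.
QuadrantWalk : Point → List Point → Point → Set
QuadrantWalk p []      e = InQuadrant p × p ≡ e
QuadrantWalk p (s ∷ w) e = InQuadrant p × QuadrantWalk (p ⊕ s) w e

inQuadrant? : ∀ p → Dec (InQuadrant p)
inQuadrant? (i , j) = (0ℤ ℤ.≤? i) ×-dec (0ℤ ℤ.≤? j)

quadrantWalk? : ∀ p w e → Dec (QuadrantWalk p w e)
quadrantWalk? p []      e = inQuadrant? p ×-dec ≡-dec ℤ._≟_ ℤ._≟_ p e
quadrantWalk? p (s ∷ w) e = inQuadrant? p ×-dec quadrantWalk? (p ⊕ s) w e

q : StepSet → ℕ → ℕ → ℕ → ℕ
q S i j n =
  length (filter (λ w → quadrantWalk? (0ℤ , 0ℤ) w (+ i , + j)) (stepSequences S n))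

-- The library has no real numbers, so ℝ is axiomatised as a
-- Cauchy-complete Archimedean ordered field.  Classically this
-- determines ℝ up to isomorphism.  No decidability of the order is
-- assumed, so that constructive real numbers are models as well.
record Reals (ℓ ℓ₁ ℓ₂ ℓ₃ : Level) : Set (lsuc (ℓ ⊔ ℓ₁ ⊔ ℓ₂ ⊔ ℓ₃)) where
  field
    heytingField : HeytingField ℓ ℓ₁ ℓ₂

  open HeytingField heytingField public
  open HeytingCommutativeRing heytingCommutativeRing public using (commutativeRing)
  open Algebra.Definitions.RawSemiring
    (Semiring.rawSemiring (CommutativeRing.semiring commutativeRing)) public
    using () renaming (_×_ to _·_)

  infix 4 _<_ ∣_∣<_
  field
    _<_                    : Rel Carrier ℓ₃
    <-isStrictPartialOrder : IsStrictPartialOrder _≈_ _<_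
    <⇒#                    : ∀ {x y} → x < y → x # y
    #⇒<⊎>                  : ∀ {x y} → x # y → x < y ⊎ y < x
    +-monoʳ-<              : ∀ x {y z} → y < z → x + y < x + z
    *-pos                  : ∀ {x y} → 0# < x → 0# < y → 0# < x * y

  ∣_∣<_ : Carrier → Carrier → Set ℓ₃
  ∣ x ∣< r = - r < x × x < r

  field
    archimedean : ∀ x → ∃[ n ] x < n · 1#
    complete    : (u : ℕ → Carrier) →
                  (∀ ε → 0# < ε → ∃[ N ] ∀ m n → N ℕ.≤ m → N ℕ.≤ n → ∣ u m - u n ∣< ε) →
                  ∃[ l ] ∀ ε → 0# < ε → ∃[ N ] ∀ n → N ℕ.≤ n → ∣ u n - l ∣< ε

module Complex {ℓ ℓ₁ ℓ₂ ℓ₃ : Level} (R : Reals ℓ ℓ₁ ℓ₂ ℓ₃) where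

  private
    module ℝ = Reals R
  open ℝ using () renaming (Carrier to ℝ)

  infix 6 _+i_
  record ℂ : Set ℓ where
    constructor _+i_
    field
      re im : ℝ
  open ℂ public

  fromℝ : ℝ → ℂ
  fromℝ x = x +i ℝ.0#

  private
    infix 4 _≈′_
    _≈′_ : Rel ℂ ℓ₁
    x ≈′ y = re x ℝ.≈ re y × im x ℝ.≈ im y

    _+′_ _*′_ : ℂ → ℂ → ℂ
    x +′ y = (re x ℝ.+ re y) +i (im x ℝ.+ im y)
    x *′ y = (re x ℝ.* re y ℝ.- im x ℝ.* im y) +i (re x ℝ.* im y ℝ.+ im x ℝ.* re y)

    -′_ : ℂ → ℂ
    -′ x = (ℝ.- re x) +i (ℝ.- im x)

    open import Algebra.Properties.Ring (CommutativeRing.ring ℝ.commutativeRing)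
      using (-1*x≈-x; -0#≈0#)
    open import Relation.Binary.Reasoning.Setoid (CommutativeRing.setoid ℝ.commutativeRing)
    open Solver (CommutativeRing.commutativeSemiring ℝ.commutativeRing)
      using (solve; _:+_; _:*_; _:=_)

    μ : ℝ
    μ = ℝ.- ℝ.1#

    x-y≈x+μy : ∀ x y → x ℝ.- y ℝ.≈ x ℝ.+ μ ℝ.* y
    x-y≈x+μy x y = ℝ.+-congˡ (ℝ.sym (-1*x≈-x y))

    minus-cong : ∀ {x y u v} → x ℝ.≈ y → u ℝ.≈ v → x ℝ.- u ℝ.≈ y ℝ.- v
    minus-cong p r = ℝ.+-cong p (ℝ.-‿cong r)

    x-0≈x : ∀ x → x ℝ.- ℝ.0# ℝ.≈ x
    x-0≈x x = ℝ.trans (ℝ.+-congˡ -0#≈0#) (ℝ.+-identityʳ x)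

    *-assoc′ : ∀ x y z → (x *′ y) *′ z ≈′ x *′ (y *′ z)
    *-assoc′ (a +i b) (d +i e) (f +i g) =
        (begin
          (a ℝ.* d ℝ.- b ℝ.* e) ℝ.* f ℝ.- (a ℝ.* e ℝ.+ b ℝ.* d) ℝ.* g
            ≈⟨ ℝ.trans (x-y≈x+μy _ _) (ℝ.+-congʳ (ℝ.*-congʳ (x-y≈x+μy _ _))) ⟩
          (a ℝ.* d ℝ.+ μ ℝ.* (b ℝ.* e)) ℝ.* f ℝ.+ μ ℝ.* ((a ℝ.* e ℝ.+ b ℝ.* d) ℝ.* g)
            ≈⟨ solve 7 (λ a b d e f g m →
                 (a :* d :+ m :* (b :* e)) :* f :+ m :* ((a :* e :+ b :* d) :* g)
                   := a :* (d :* f :+ m :* (e :* g)) :+ m :* (b :* (d :* g :+ e :* f)))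
                 ℝ.refl a b d e f g μ ⟩
          a ℝ.* (d ℝ.* f ℝ.+ μ ℝ.* (e ℝ.* g)) ℝ.+ μ ℝ.* (b ℝ.* (d ℝ.* g ℝ.+ e ℝ.* f))
            ≈⟨ ℝ.trans (x-y≈x+μy _ _) (ℝ.+-congʳ (ℝ.*-congˡ (x-y≈x+μy _ _))) ⟨
          a ℝ.* (d ℝ.* f ℝ.- e ℝ.* g) ℝ.- b ℝ.* (d ℝ.* g ℝ.+ e ℝ.* f) ∎)
      , (begin
          (a ℝ.* d ℝ.- b ℝ.* e) ℝ.* g ℝ.+ (a ℝ.* e ℝ.+ b ℝ.* d) ℝ.* f
            ≈⟨ ℝ.+-congʳ (ℝ.*-congʳ (x-y≈x+μy _ _)) ⟩
          (a ℝ.* d ℝ.+ μ ℝ.* (b ℝ.* e)) ℝ.* g ℝ.+ (a ℝ.* e ℝ.+ b ℝ.* d) ℝ.* f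
            ≈⟨ solve 7 (λ a b d e f g m →
                 (a :* d :+ m :* (b :* e)) :* g :+ (a :* e :+ b :* d) :* f
                   := a :* (d :* g :+ e :* f) :+ b :* (d :* f :+ m :* (e :* g)))
                 ℝ.refl a b d e f g μ ⟩
          a ℝ.* (d ℝ.* g ℝ.+ e ℝ.* f) ℝ.+ b ℝ.* (d ℝ.* f ℝ.+ μ ℝ.* (e ℝ.* g))
            ≈⟨ ℝ.+-congˡ (ℝ.*-congˡ (x-y≈x+μy _ _)) ⟨
          a ℝ.* (d ℝ.* g ℝ.+ e ℝ.* f) ℝ.+ b ℝ.* (d ℝ.* f ℝ.- e ℝ.* g) ∎)

    *-comm′ : ∀ x y → x *′ y ≈′ y *′ x
    *-comm′ (a +i b) (d +i e) =
        minus-cong (ℝ.*-comm a d) (ℝ.*-comm b e)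
      , solve 4 (λ a b d e → a :* e :+ b :* d := d :* b :+ e :* a) ℝ.refl a b d e

    *-identityˡ′ : ∀ x → fromℝ ℝ.1# *′ x ≈′ x
    *-identityˡ′ (a +i b) =
        ℝ.trans (minus-cong (ℝ.*-identityˡ a) (ℝ.zeroˡ b)) (x-0≈x a)
      , ℝ.trans (ℝ.+-cong (ℝ.*-identityˡ b) (ℝ.zeroˡ a)) (ℝ.+-identityʳ b)

    distribˡ′ : ∀ x y z → x *′ (y +′ z) ≈′ (x *′ y) +′ (x *′ z)
    distribˡ′ (a +i b) (d +i e) (f +i g) =
        (begin
          a ℝ.* (d ℝ.+ f) ℝ.- b ℝ.* (e ℝ.+ g)
            ≈⟨ x-y≈x+μy _ _ ⟩
          a ℝ.* (d ℝ.+ f) ℝ.+ μ ℝ.* (b ℝ.* (e ℝ.+ g))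
            ≈⟨ solve 7 (λ a b d e f g m →
                 a :* (d :+ f) :+ m :* (b :* (e :+ g))
                   := (a :* d :+ m :* (b :* e)) :+ (a :* f :+ m :* (b :* g)))
                 ℝ.refl a b d e f g μ ⟩
          (a ℝ.* d ℝ.+ μ ℝ.* (b ℝ.* e)) ℝ.+ (a ℝ.* f ℝ.+ μ ℝ.* (b ℝ.* g))
            ≈⟨ ℝ.+-cong (x-y≈x+μy _ _) (x-y≈x+μy _ _) ⟨
          (a ℝ.* d ℝ.- b ℝ.* e) ℝ.+ (a ℝ.* f ℝ.- b ℝ.* g) ∎)
      , solve 6 (λ a b d e f g →
          a :* (e :+ g) :+ b :* (d :+ f) := (a :* e :+ b :* d) :+ (a :* g :+ b :* f))
          ℝ.refl a b d e f g

  commutativeRing : CommutativeRing ℓ ℓ₁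
  commutativeRing = record
    { Carrier = ℂ
    ; _≈_ = _≈′_
    ; _+_ = _+′_
    ; _*_ = _*′_
    ; -_  = -′_
    ; 0#  = fromℝ ℝ.0#
    ; 1#  = fromℝ ℝ.1#
    ; isCommutativeRing = record
      { isRing = record
        { +-isAbelianGroup = record
          { isGroup = record
            { isMonoid = record
              { isSemigroup = record
                { isMagma = record
                  { isEquivalence = record
                    { refl  = ℝ.refl , ℝ.refl
                    ; sym   = λ (p , r) → ℝ.sym p , ℝ.sym r
                    ; trans = λ (p , r) (s , t) → ℝ.trans p s , ℝ.trans r t
                    }
                  ; ∙-cong = λ (p , r) (s , t) → ℝ.+-cong p s , ℝ.+-cong r t
                  }
                ; assoc = λ x y z → ℝ.+-assoc _ _ _ , ℝ.+-assoc _ _ _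
                }
              ; identity = (λ x → ℝ.+-identityˡ _ , ℝ.+-identityˡ _)
                         , (λ x → ℝ.+-identityʳ _ , ℝ.+-identityʳ _)
              }
            ; inverse = (λ x → ℝ.-‿inverseˡ _ , ℝ.-‿inverseˡ _)
                      , (λ x → ℝ.-‿inverseʳ _ , ℝ.-‿inverseʳ _)
            ; ⁻¹-cong = λ (p , r) → ℝ.-‿cong p , ℝ.-‿cong r
            }
          ; comm = λ x y → ℝ.+-comm _ _ , ℝ.+-comm _ _
          }
        ; *-cong = λ (p , r) (s , t) →
              minus-cong (ℝ.*-cong p s) (ℝ.*-cong r t)
            , ℝ.+-cong (ℝ.*-cong p t) (ℝ.*-cong r s)
        ; *-assoc = *-assoc′
        ; *-identity = *-identityˡ′
                     , λ x → trans′ (*-comm′ x (fromℝ ℝ.1#)) (*-identityˡ′ x)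
        ; distrib = distribˡ′
                  , λ x y z → trans′ (*-comm′ (y +′ z) x)
                                (trans′ (distribˡ′ x y z)
                                  (+-cong′ (*-comm′ x y) (*-comm′ x z)))
        }
      ; *-comm = *-comm′
      }
    }
    where
    trans′ : ∀ {x y z} → x ≈′ y → y ≈′ z → x ≈′ z
    trans′ (p , r) (s , t) = ℝ.trans p s , ℝ.trans r t
    +-cong′ : ∀ {x y u v} → x ≈′ y → u ≈′ v → x +′ u ≈′ y +′ v
    +-cong′ (p , r) (s , t) = ℝ.+-cong p s , ℝ.+-cong r t

  open CommutativeRing commutativeRing public
    hiding (Carrier)
  open Algebra.Definitions.RawSemiring (Semiring.rawSemiring semiring) public
    using (_^_; sum) renaming (_×_ to _·_)

  ∣_∣² : ℂ → ℝ
  ∣ w ∣² = re w ℝ.* re w ℝ.+ im w ℝ.* im w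

  -- Moduli are only ever compared, and for nonnegative reals s < t is
  -- s² < t²; this avoids the real square root.
  infix 4 ∣_∣<_ ∣_∣≤∣_∣ _≈1/_
  ∣_∣<_ : ℂ → ℝ → Set ℓ₃
  ∣ w ∣< r = ℝ.0# ℝ.< r × ∣ w ∣² ℝ.< r ℝ.* r

  ∣_∣≤∣_∣ : ℂ → ℂ → Set ℓ₃
  ∣ v ∣≤∣ w ∣ = ¬ (∣ w ∣² ℝ.< ∣ v ∣²)

  -- Apartness from 0, which classically is w ≉ 0#.
  Nonzero : ℂ → Set ℓ₃
  Nonzero w = ℝ.0# ℝ.< ∣ w ∣²

  _≈1/_ : ℂ → ℂ → Set ℓ₁
  r ≈1/ w = r * w ≈ 1#

  ∑<_ : ℕ → (ℕ → ℂ) → ℂ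
  (∑< n) f = sum {n} (f ∘ toℕ)

  infix 4 ∑_≈_ ∑³_≈_
  ∑_≈_ : (ℕ → ℂ) → ℂ → Set (ℓ ⊔ ℓ₃)
  ∑ f ≈ l = ∀ ε → ℝ.0# ℝ.< ε → ∃[ N ] ∀ n → N ℕ.≤ n → ∣ (∑< n) f - l ∣< ε

  -- A triple series converges when its partial sums over boxes
  -- [0,I) × [0,J) × [0,M) do as I, J and M tend to ∞ independently.
  ∑³_≈_ : (ℕ → ℕ → ℕ → ℂ) → ℂ → Set (ℓ ⊔ ℓ₃)
  ∑³ f ≈ l =
    ∀ ε → ℝ.0# ℝ.< ε → ∃[ N ] ∀ I J M → N ℕ.≤ I → N ℕ.≤ J → N ℕ.≤ M →
    ∣ (∑< I) (λ i → (∑< J) (λ j → (∑< M) (λ n → f i j n))) - l ∣< ε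

module Walks {ℓ ℓ₁ ℓ₂ ℓ₃ : Level} (R : Reals ℓ ℓ₁ ℓ₂ ℓ₃) where

  open Complex R public
  private
    module ℝ = Reals R

  Q[_]⟨_,_,_⟩≈_ : StepSet → ℂ → ℂ → ℂ → ℂ → Set (ℓ ⊔ ℓ₃)
  Q[ S ]⟨ x , y , z ⟩≈ v = ∑³ (λ i j n → q S i j n · (x ^ i * y ^ j * z ^ n)) ≈ v

  -- x ↑ i is x^{i+1}, a polynomial in x for every coordinate i ≥ -1 of a step.
  infixr 8 _↑_
  _↑_ : ℂ → ℤ → ℂ
  x ↑ i = x ^ ∣ 1ℤ ℤ.+ i ∣

  sumList : List ℂ → ℂ
  sumList = foldr _+_ 0#

  -- xyz [ Σ_{(i,j)∈S} x^i y^j - 1/z ]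
  kernel : StepSet → ℂ → ℂ → ℂ → ℂ
  kernel S z x y = z * sumList (map (λ (i , j) → x ↑ i * y ↑ j) S) - x * y

  -- x Σ_{(i,j)∈S} x^i for a fixed j
  row : StepSet → ℤ → ℂ → ℂ
  row S j x = sumList (map (λ s → x ↑ proj₁ s) (filter (λ s → proj₂ s ℤ.≟ j) S))

  a b c disc : StepSet → ℂ → ℂ → ℂ
  a S z x = z * row S 1ℤ x
  -- The term -xy of the kernel contributes -x here.
  b S z x = - x + z * row S 0ℤ x
  c S z x = z * row S -1ℤ x
  disc S z x = b S z x * b S z x - 4 · (a S z x * c S z x)

  kernel-quadratic : ∀ S → All (λ s → proj₂ s ∈ (1ℤ ∷ 0ℤ ∷ -1ℤ ∷ [])) S → ∀ z x y →
    kernel S z x y ≈ a S z x * y ^ 2 + b S z x * y + c S z x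
  kernel-quadratic S small z x y = begin
    z * sumList (map (λ (i , j) → x ↑ i * y ↑ j) S) - x * y
      ≈⟨ +-cong (*-congˡ (rows S small)) (-‿distribˡ-* x y) ⟩
    z * (row S 1ℤ x * y ^ 2 + row S 0ℤ x * y + row S -1ℤ x) + - x * y
      ≈⟨ solve 7 (λ z p₁ p₀ p₋ y y² x⁻ →
           z :* (p₁ :* y² :+ p₀ :* y :+ p₋) :+ x⁻ :* y
             := z :* p₁ :* y² :+ (x⁻ :+ z :* p₀) :* y :+ z :* p₋)
           refl z (row S 1ℤ x) (row S 0ℤ x) (row S -1ℤ x) y (y ^ 2) (- x) ⟩
    a S z x * y ^ 2 + b S z x * y + c S z x ∎
    where
    open import Algebra.Properties.Ring ring using (-‿distribˡ-*)
    open import Relation.Binary.Reasoning.Setoid setoid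
    open Solver commutativeSemiring using (solve; _:+_; _:*_; _:=_; con)
    rows : ∀ S → All (λ s → proj₂ s ∈ (1ℤ ∷ 0ℤ ∷ -1ℤ ∷ [])) S →
      sumList (map (λ (i , j) → x ↑ i * y ↑ j) S)
        ≈ row S 1ℤ x * y ^ 2 + row S 0ℤ x * y + row S -1ℤ x
    rows [] [] = solve 2 (λ y y² → con 0 := con 0 :* y² :+ con 0 :* y :+ con 0) refl y (y ^ 2)
    rows ((i , _) ∷ S) (here ≡.refl ∷ small) = trans (+-congˡ (rows S small))
      (solve 6 (λ u p₁ p₀ p₋ y y² →
         u :* y² :+ (p₁ :* y² :+ p₀ :* y :+ p₋) := (u :+ p₁) :* y² :+ p₀ :* y :+ p₋)
         refl (x ↑ i) (row S 1ℤ x) (row S 0ℤ x) (row S -1ℤ x) y (y ^ 2))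
    rows ((i , _) ∷ S) (there (here ≡.refl) ∷ small) = trans (+-congˡ (rows S small))
      (solve 6 (λ u p₁ p₀ p₋ y y² →
         u :* (y :* con 1) :+ (p₁ :* y² :+ p₀ :* y :+ p₋) := p₁ :* y² :+ (u :+ p₀) :* y :+ p₋)
         refl (x ↑ i) (row S 1ℤ x) (row S 0ℤ x) (row S -1ℤ x) y (y ^ 2))
    rows ((i , _) ∷ S) (there (there (here ≡.refl)) ∷ small) = trans (+-congˡ (rows S small))
      (solve 6 (λ u p₁ p₀ p₋ y y² →
         u :* con 1 :+ (p₁ :* y² :+ p₀ :* y :+ p₋) := p₁ :* y² :+ p₀ :* y :+ (u :+ p₋))
         refl (x ↑ i) (row S 1ℤ x) (row S 0ℤ x) (row S -1ℤ x) y (y ^ 2))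

  -- y₀ = (-b + d^{1/2}) / (2a), where the sign of d^{1/2} is chosen so
  -- that the modulus of y₀ does not exceed that of the conjugate root y₁.
  record SmallerRoot (S : StepSet) (z x y₀ : ℂ) : Set (ℓ ⊔ ℓ₁ ⊔ ℓ₃) where
    field
      √d 1/2a y₁ : ℂ
      √d*√d≈d    : √d * √d ≈ disc S z x
      1/2a-spec  : 1/2a ≈1/ (2 · a S z x)
      y₀-spec    : y₀ ≈ (- b S z x + √d) * 1/2a
      y₁-spec    : y₁ ≈ (- b S z x - √d) * 1/2a
      ∣y₀∣≤∣y₁∣  : ∣ y₀ ∣≤∣ y₁ ∣

  IsY₀ : StepSet → ℂ → (ℂ → ℂ) → Set (ℓ ⊔ ℓ₁ ⊔ ℓ₃)
  IsY₀ S z Y₀ = ∀ x → ∣ x ∣< ℝ.1# → SmallerRoot S z x (Y₀ x)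

  -- Exchanging the coordinates turns K(x,y) into K(y,x), hence ã, b̃ and c̃
  -- are a, b and c for the exchanged step set.
  IsX₀ : StepSet → ℂ → (ℂ → ℂ) → Set (ℓ ⊔ ℓ₁ ⊔ ℓ₃)
  IsX₀ S = IsY₀ (exchange S)

  open import Function.Endo.Propositional ℂ public
    using () renaming (_^_ to _^∘_)

  -- F∘(G∘F)^{∘p}(x) [ (G∘F)^{∘p}(x) - (G∘F)^{∘(p+1)}(x) ]
  term : (F G : ℂ → ℂ) → ℂ → ℕ → ℂ
  term F G x p = F (((G ∘ F) ^∘ p) x) * (((G ∘ F) ^∘ p) x - ((G ∘ F) ^∘ suc p) x)

-- For x in the unit disc put y = Y₀(x) and t = y/x, so that the kernel equation
-- becomes t = z Σ_{(i,j)∈S} x^{i+j} t^{j+1}, where i + j ≥ 0 on a singular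
-- step set.  Comparing with Vieta's formulas, the smaller root satisfies
-- |t| ≤ θ := kz < 1, so X₀ and Y₀ are contractions towards 0.  On the kernel
-- curve the functional equation reads
--   z x² Q(x,0) + z y² Q(0,y) = x y,
-- and subtracting it at (x_p, y_p) and (x_{p+1}, y_p), where x_p = (X₀∘Y₀)^{∘p}(x)
-- and y_p = Y₀(x_p), turns z x² Q(x,0) into a telescoping series.  All series
-- are truncated at length M; the errors are O(θ^M) because the steps have
-- total weight θ.
module Submission where

open import Defs
open import Algebra.Bundles using (CommutativeRing; Semiring)
import Algebra.Apartness.Properties.HeytingCommutativeRing
import Algebra.Definitions.RawSemiring
import Algebra.Properties.AbelianGroup
import Algebra.Properties.Ring
import Algebra.Properties.Semiring.Exp
import Algebra.Properties.Semiring.Mult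
import Algebra.Properties.Semiring.Mult.TCOptimised
import Algebra.Solver.Ring
open import Algebra.Solver.Ring.AlmostCommutativeRing
  using (fromCommutativeRing; _-Raw-AlmostCommutative⟶_)
open import Data.Empty using (⊥-elim)
open import Data.Fin.Base using (toℕ)
open import Data.Integer.Base as ℤ using (ℤ; +_; -[1+_]; _⊖_; 0ℤ; 1ℤ; -1ℤ)
import Data.Integer.Properties as ℤ
open import Data.List.Base
  using (List; []; _∷_; map; filter; length; foldr; cartesianProductWith)
open import Data.List.Membership.Propositional using (_∈_)
open import Data.List.Properties
  using (filter-++; filter-none; filter-accept; filter-reject; filter-≐; length-++; length-map)
open import Data.List.Relation.Unary.All as All using (All; []; _∷_)
open import Data.List.Relation.Unary.Any using (here; there)
open import Data.Maybe.Base using (Maybe; just; nothing)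
open import Data.Nat.Base as ℕ using (ℕ; zero; suc)
import Data.Nat.Properties as ℕ
open import Data.Product.Base using (_×_; _,_; proj₁; proj₂; ∃-syntax; swap)
open import Data.Sum.Base using (_⊎_; inj₁; inj₂; [_,_]′)
open import Data.Unit.Base using (⊤)
open import Function.Base using (_∘_; id)
open import Level using (_⊔_)
import Relation.Binary.Reasoning.Base.Triple
import Relation.Binary.Reasoning.Setoid
open import Relation.Binary.PropositionalEquality.Core as ≡ using (_≡_)
open import Relation.Binary.Structures using (IsStrictPartialOrder; IsPreorder)
open import Relation.Nullary.Decidable.Core using (yes; no)
open import Relation.Nullary.Negation using (¬_)
open import Relation.Unary using (Pred; Decidable)

-- Three obstacles shape the argument. The order is not decidable, so `≤` is the negation of the
-- reversed `<`: weak inequalities are proved by refutation, and all moduli are compared through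
-- their squares. The quotient t = y/x cannot be formed, since the contraction bounds are needed for
-- every point of the disc, 0 included. Instead b and c are shown to carry the factors x and x²,
-- which makes every estimate homogeneous in x. Finally, convergence of Q(x,0) is not known
-- beforehand. The truncated functional equation is a finite identity valid for each M, the number s
-- is constructed on the side of the iteration series, and the truncated sums of z x² Q(x,0) are
-- then shown to approach s. For this last step the number of iterations is set equal to the
-- truncation length, so that a single rate θ^M controls the equation errors, the boundary term at
-- the last iterate and the tail of the series.

-- Integer coefficients let the solver recognise cancellations although the ring
-- need not have decidable equality.
module IntegerSolver {c ℓ} (A : CommutativeRing c ℓ) where
  open CommutativeRing A
  open Algebra.Properties.Ring ring
  open Algebra.Properties.Semiring.Mult.TCOptimised semiring
    using () renaming (_×_ to _·_; ×-homo-+ to ·-homo-+; 1+× to 1+·)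
  open Algebra.Properties.AbelianGroup +-abelianGroup using (⁻¹-∙-comm)
  open Relation.Binary.Reasoning.Setoid setoid

  -- With the optimised multiples, con 1ℤ denotes 1# itself and not 1# + 0#.
  fromℤ : ℤ → Carrier
  fromℤ (+ n)    = n · 1#
  fromℤ -[1+ n ] = - (suc n · 1#)

  fromℤ-⊖ : ∀ m n → fromℤ (m ⊖ n) ≈ m · 1# - n · 1#
  fromℤ-⊖ m zero = sym (trans (+-congˡ -0#≈0#) (+-identityʳ _))
  fromℤ-⊖ zero (suc n) = sym (+-identityˡ _)
  fromℤ-⊖ (suc m) (suc n) = begin
    fromℤ (suc m ⊖ suc n)                     ≡⟨ ≡.cong fromℤ (ℤ.[1+m]⊖[1+n]≡m⊖n m n) ⟩
    fromℤ (m ⊖ n)                             ≈⟨ fromℤ-⊖ m n ⟩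
    m · 1# - n · 1#                           ≈⟨ +-congʳ (+-identityˡ _) ⟨
    (0# + m · 1#) - n · 1#                    ≈⟨ +-congʳ (+-congʳ (-‿inverseʳ 1#)) ⟨
    ((1# - 1#) + m · 1#) - n · 1#             ≈⟨ +-congʳ (+-assoc _ _ _) ⟩
    (1# + (- 1# + m · 1#)) - n · 1#           ≈⟨ +-congʳ (+-congˡ (+-comm _ _)) ⟩
    (1# + (m · 1# - 1#)) - n · 1#             ≈⟨ +-congʳ (+-assoc _ _ _) ⟨
    ((1# + m · 1#) - 1#) - n · 1#             ≈⟨ +-assoc _ _ _ ⟩
    (1# + m · 1#) + (- 1# - n · 1#)           ≈⟨ +-congˡ (⁻¹-∙-comm _ _) ⟩
    (1# + m · 1#) - (1# + n · 1#)             ≈⟨ +-cong (1+· m 1#) (-‿cong (1+· n 1#)) ⟨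
    suc m · 1# - suc n · 1#                   ∎

  fromℤ-neg : ∀ i → fromℤ (ℤ.- i) ≈ - fromℤ i
  fromℤ-neg (+ zero)  = sym -0#≈0#
  fromℤ-neg (+ suc n) = refl
  fromℤ-neg -[1+ n ]  = sym (-‿involutive _)

  fromℤ-+ : ∀ i j → fromℤ (i ℤ.+ j) ≈ fromℤ i + fromℤ j
  fromℤ-+ (+ m) (+ n) = ·-homo-+ 1# m n
  fromℤ-+ (+ m) -[1+ n ] = fromℤ-⊖ m (suc n)
  fromℤ-+ -[1+ m ] (+ n) = trans (fromℤ-⊖ n (suc m)) (+-comm _ _)
  fromℤ-+ -[1+ m ] -[1+ n ] = begin
    - (suc (suc (m ℕ.+ n)) · 1#)    ≈⟨ -‿cong (1+· (suc m ℕ.+ n) 1#) ⟩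
    - (1# + (suc m ℕ.+ n) · 1#)     ≈⟨ -‿cong (+-congˡ (·-homo-+ 1# (suc m) n)) ⟩
    - (1# + (suc m · 1# + n · 1#))  ≈⟨ -‿cong (+-assoc _ _ _) ⟨
    - ((1# + suc m · 1#) + n · 1#)  ≈⟨ -‿cong (+-congʳ (+-comm _ _)) ⟩
    - ((suc m · 1# + 1#) + n · 1#)  ≈⟨ -‿cong (+-assoc _ _ _) ⟩
    - (suc m · 1# + (1# + n · 1#))  ≈⟨ -‿cong (+-congˡ (1+· n 1#)) ⟨
    - (suc m · 1# + suc n · 1#)     ≈⟨ ⁻¹-∙-comm _ _ ⟨
    - (suc m · 1#) - suc n · 1#     ∎

  fromℤ-*ⁿ : ∀ m i → fromℤ (+ m ℤ.* i) ≈ m · 1# * fromℤ i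
  fromℤ-*ⁿ zero i = sym (zeroˡ _)
  fromℤ-*ⁿ (suc m) i = begin
    fromℤ (+ suc m ℤ.* i)                  ≡⟨ ≡.cong fromℤ (ℤ.suc-* (+ m) i) ⟩
    fromℤ (i ℤ.+ + m ℤ.* i)                ≈⟨ fromℤ-+ i (+ m ℤ.* i) ⟩
    fromℤ i + fromℤ (+ m ℤ.* i)            ≈⟨ +-cong (sym (*-identityˡ _)) (fromℤ-*ⁿ m i) ⟩
    1# * fromℤ i + m · 1# * fromℤ i        ≈⟨ distribʳ _ _ _ ⟨
    (1# + m · 1#) * fromℤ i                ≈⟨ *-congʳ (1+· m 1#) ⟨
    suc m · 1# * fromℤ i                   ∎

  fromℤ-* : ∀ i j → fromℤ (i ℤ.* j) ≈ fromℤ i * fromℤ j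
  fromℤ-* (+ m) j = fromℤ-*ⁿ m j
  fromℤ-* -[1+ m ] j = begin
    fromℤ (-[1+ m ] ℤ.* j)        ≡⟨ ≡.cong fromℤ (ℤ.neg-distribˡ-* (+ suc m) j) ⟨
    fromℤ (ℤ.- (+ suc m ℤ.* j))   ≈⟨ fromℤ-neg (+ suc m ℤ.* j) ⟩
    - fromℤ (+ suc m ℤ.* j)       ≈⟨ -‿cong (fromℤ-*ⁿ (suc m) j) ⟩
    - (suc m · 1# * fromℤ j)      ≈⟨ -‿distribˡ-* _ _ ⟩
    fromℤ -[1+ m ] * fromℤ j      ∎

  fromℤ-morphism : CommutativeRing.rawRing ℤ.+-*-commutativeRing
                     -Raw-AlmostCommutative⟶ fromCommutativeRing A
  fromℤ-morphism = record
    { ⟦_⟧    = fromℤ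
    ; +-homo = fromℤ-+
    ; *-homo = fromℤ-*
    ; -‿homo = fromℤ-neg
    ; 0-homo = refl
    ; 1-homo = refl
    }

  fromℤ-≟ : ∀ i j → Maybe (fromℤ i ≈ fromℤ j)
  fromℤ-≟ i j with i ℤ.≟ j
  ... | yes ≡.refl = just refl
  ... | no _       = nothing

  open Algebra.Solver.Ring _ (fromCommutativeRing A) fromℤ-morphism fromℤ-≟ public
    using (solve; _:=_; _:+_; _:*_; _:-_; :-_; con)

-- Order, square comparison and null sequences in a constructive real field.

module RealOrder {ℓ ℓ₁ ℓ₂ ℓ₃} (R : Reals ℓ ℓ₁ ℓ₂ ℓ₃) where
  open Reals R public
  open Algebra.Apartness.Properties.HeytingCommutativeRing heytingCommutativeRing
    using (1#0; invertibleˡ⇒#)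
  open CommutativeRing commutativeRing public using (ring; semiring)
  open Algebra.Properties.Ring ring public using (-0#≈0#; -‿involutive)
  open Algebra.Properties.Semiring.Mult semiring public using (×-congʳ; ×-homo-+; ×-assoc-*; ×-comm-*)
  open Algebra.Properties.Semiring.Exp semiring public using (_^_)
  open IsStrictPartialOrder <-isStrictPartialOrder public
    using (<-resp-≈; <-respʳ-≈; <-respˡ-≈) renaming (irrefl to <-irrefl; trans to <-trans; asym to <-asym)
  open IntegerSolver commutativeRing public
    using (solve; _:=_; _:+_; _:*_; _:-_; :-_; con)

  infix 4 _≤_
  -- A disjunction of `<` and `≈` could not be established constructively; the negation can, and by
  -- cotransitivity it still composes with `<`.
  _≤_ : Carrier → Carrier → Set ℓ₃
  x ≤ y = ¬ (y < x)

  -- The substitute for trichotomy. Cotransitivity of apartness compares `w` with one of the ends;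
  -- if the comparison has the wrong direction, transitivity with `x < y` yields the other
  -- alternative.
  <-cotrans : ∀ {x y} → x < y → ∀ w → x < w ⊎ w < y
  <-cotrans x<y w with #-cotrans (<⇒# x<y) w
  ... | inj₁ x#w with #⇒<⊎> x#w
  ...   | inj₁ x<w = inj₁ x<w
  ...   | inj₂ w<x = inj₂ (<-trans w<x x<y)
  <-cotrans x<y w | inj₂ w#y with #⇒<⊎> w#y
  ...   | inj₁ w<y = inj₂ w<y
  ...   | inj₂ y<w = inj₁ (<-trans x<y y<w)

  ≤-refl : ∀ {x} → x ≤ x
  ≤-refl = <-irrefl refl

  ≤-reflexive : ∀ {x y} → x ≈ y → x ≤ y
  ≤-reflexive x≈y = <-irrefl (sym x≈y)

  <⇒≤ : ∀ {x y} → x < y → x ≤ y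
  <⇒≤ = <-asym

  <-≤-trans : ∀ {x y z} → x < y → y ≤ z → x < z
  <-≤-trans {z = z} x<y y≤z with <-cotrans x<y z
  ... | inj₁ x<z = x<z
  ... | inj₂ z<y = ⊥-elim (y≤z z<y)

  ≤-<-trans : ∀ {x y z} → x ≤ y → y < z → x < z
  ≤-<-trans {x} x≤y y<z with <-cotrans y<z x
  ... | inj₁ y<x = ⊥-elim (x≤y y<x)
  ... | inj₂ x<z = x<z

  ≤-trans : ∀ {x y z} → x ≤ y → y ≤ z → x ≤ z
  ≤-trans x≤y y≤z z<x = y≤z (<-≤-trans z<x x≤y)

  ≤-isPreorder : IsPreorder _≈_ _≤_
  ≤-isPreorder = record
    { isEquivalence = isEquivalence ; reflexive = ≤-reflexive ; trans = ≤-trans }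

  module ≤-Reasoning = Relation.Binary.Reasoning.Base.Triple
    ≤-isPreorder <-asym <-trans <-resp-≈ <⇒≤ <-≤-trans ≤-<-trans
  open ≤-Reasoning

  x<y⇒0<y-x : ∀ {x y} → x < y → 0# < y - x
  x<y⇒0<y-x {x} {y} x<y = begin-strict
    0#       ≈⟨ -‿inverseˡ x ⟨
    - x + x  <⟨ +-monoʳ-< (- x) x<y ⟩
    - x + y  ≈⟨ +-comm _ _ ⟩
    y - x    ∎

  0<d⇒x<x+d : ∀ {x y d} → 0# < d → y ≈ x + d → x < y
  0<d⇒x<x+d {x} {y} {d} 0<d y≈x+d = begin-strict
    x       ≈⟨ +-identityʳ x ⟨
    x + 0#  <⟨ +-monoʳ-< x 0<d ⟩
    x + d   ≈⟨ y≈x+d ⟨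
    y       ∎

  0≤d⇒x≤x+d : ∀ {x y d} → 0# ≤ d → y ≈ x + d → x ≤ y
  0≤d⇒x≤x+d {x} {y} {d} 0≤d y≈x+d y<x = 0≤d (begin-strict
    d        ≈⟨ solve 2 (λ x d → d := (x :+ d) :- x) refl x d ⟩
    (x + d) - x  ≈⟨ +-cong (sym y≈x+d) refl ⟩
    y - x    ≈⟨ +-comm _ _ ⟩
    - x + y  <⟨ +-monoʳ-< (- x) y<x ⟩
    - x + x  ≈⟨ -‿inverseˡ x ⟩
    0#       ∎)

  x≤y⇒0≤y-x : ∀ {x y} → x ≤ y → 0# ≤ y - x
  x≤y⇒0≤y-x {x} {y} x≤y y-x<0 = x≤y (0<d⇒x<x+d (x<y⇒0<y-x y-x<0)
    (solve 2 (λ x y → x := y :+ (con 0ℤ :- (y :- x))) refl x y))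

  +-mono-≤ : ∀ {x y u v} → x ≤ y → u ≤ v → x + u ≤ y + v
  +-mono-≤ {x} {y} {u} {v} x≤y u≤v = ≤-trans (mono x u≤v)
    (≤-trans (≤-reflexive (+-comm x v)) (≤-trans (mono v x≤y) (≤-reflexive (+-comm v y))))
    where
    mono : ∀ x {u v} → u ≤ v → x + u ≤ x + v
    mono x {u} {v} u≤v = 0≤d⇒x≤x+d (x≤y⇒0≤y-x u≤v)
      (solve 3 (λ x u v → x :+ v := (x :+ u) :+ (v :- u)) refl x u v)

  +-nonneg : ∀ {x y} → 0# ≤ x → 0# ≤ y → 0# ≤ x + y
  +-nonneg 0≤x 0≤y = ≤-trans (≤-reflexive (sym (+-identityʳ 0#))) (+-mono-≤ 0≤x 0≤y)

  +-pos-nonneg : ∀ {x y} → 0# < x → 0# ≤ y → 0# < x + y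
  +-pos-nonneg 0<x 0≤y = <-≤-trans 0<x (0≤d⇒x≤x+d 0≤y refl)

  neg-mono-< : ∀ {x y} → x < y → - y < - x
  neg-mono-< {x} {y} x<y = 0<d⇒x<x+d (x<y⇒0<y-x x<y)
    (solve 2 (λ x y → :- x := :- y :+ (y :- x)) refl x y)

  x<0⇒0<-x : ∀ {x} → x < 0# → 0# < - x
  x<0⇒0<-x x<0 = <-respˡ-≈ -0#≈0# (neg-mono-< x<0)

  0<1 : 0# < 1#
  0<1 with #⇒<⊎> 1#0
  ... | inj₂ 0<1 = 0<1
  ... | inj₁ 1<0 = <-respʳ-≈ (solve 0 ((:- con 1ℤ) :* (:- con 1ℤ) := con 1ℤ) refl)
                     (*-pos (x<0⇒0<-x 1<0) (x<0⇒0<-x 1<0))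

  0≤1 : 0# ≤ 1#
  0≤1 = <⇒≤ 0<1

  x#0⇒0<x² : ∀ {x} → x # 0# → 0# < x * x
  x#0⇒0<x² {x} x#0 with #⇒<⊎> x#0
  ... | inj₂ 0<x = *-pos 0<x 0<x
  ... | inj₁ x<0 = <-respʳ-≈ (solve 1 (λ x → (:- x) :* (:- x) := x :* x) refl x)
                     (*-pos (x<0⇒0<-x x<0) (x<0⇒0<-x x<0))

  x*y≈1⇒x#0 : ∀ {x y} → x * y ≈ 1# → x # 0#
  x*y≈1⇒x#0 {x} {y} xy≈1 = invertibleˡ⇒# (y , trans
    (solve 2 (λ x y → y :* (x :- con 0ℤ) := x :* y) refl x y) xy≈1)

  xy#0⇒x#0 : ∀ {x y} → x * y # 0# → x # 0#
  xy#0⇒x#0 {x} {y} xy#0 = x*y≈1⇒x#0 {x} {y * proj₁ invertible} (trans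
    (solve 3 (λ x y w → x :* (y :* w) := w :* (x :* y :- con 0ℤ)) refl x y (proj₁ invertible))
    (proj₁ (proj₂ invertible)))
    where
    invertible = #⇒invertible xy#0

  pos-inverse : ∀ {x} → 0# < x → ∃[ y ] 0# < y × x * y ≈ 1#
  pos-inverse {x} 0<x = y , [ (λ y<0 → ⊥-elim (y≮0 y<0)) , id ]′ (#⇒<⊎> y#0) , xy≈1
    where
    invertible = #⇒invertible (#-sym (<⇒# 0<x))
    y : Carrier
    y = proj₁ invertible
    xy≈1 : x * y ≈ 1#
    xy≈1 = trans (solve 2 (λ x y → x :* y := y :* (x :- con 0ℤ)) refl x y) (proj₁ (proj₂ invertible))
    y#0 : y # 0#
    y#0 = x*y≈1⇒x#0 (trans (*-comm y x) xy≈1)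
    y≮0 : 0# ≤ y
    y≮0 y<0 = <-asym (*-pos 0<x (x<0⇒0<-x y<0)) (begin-strict
      x * (- y)  ≈⟨ solve 2 (λ x y → x :* (:- y) := :- (x :* y)) refl x y ⟩
      - (x * y)  ≈⟨ -‿cong xy≈1 ⟩
      - 1#       <⟨ neg-mono-< 0<1 ⟩
      - 0#       ≈⟨ -0#≈0# ⟩
      0#         ∎)

  -- A negative product is invertible, hence both factors are apart from zero. Being nonnegative,
  -- they are then positive, and so is their product. No case split on signs is needed.
  *-nonneg : ∀ {x y} → 0# ≤ x → 0# ≤ y → 0# ≤ x * y
  *-nonneg {x} {y} 0≤x 0≤y xy<0 = <-asym xy<0 (*-pos
    (positive x y 0≤x xy<0) (positive y x 0≤y (<-respˡ-≈ (*-comm x y) xy<0)))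
    where
    positive : ∀ x y → 0# ≤ x → x * y < 0# → 0# < x
    positive x y 0≤x xy<0 =
      [ (λ x<0 → ⊥-elim (0≤x x<0)) , id ]′ (#⇒<⊎> (xy#0⇒x#0 {x} {y} (<⇒# xy<0)))

  x²-nonneg : ∀ x → 0# ≤ x * x
  x²-nonneg x x²<0 = <-asym x²<0 (x#0⇒0<x² (xy#0⇒x#0 {x} {x} (<⇒# x²<0)))

  *-monoˡ-≤ : ∀ {z x y} → 0# ≤ z → x ≤ y → z * x ≤ z * y
  *-monoˡ-≤ {z} {x} {y} 0≤z x≤y = 0≤d⇒x≤x+d (*-nonneg 0≤z (x≤y⇒0≤y-x x≤y))
    (solve 3 (λ x y z → z :* y := z :* x :+ z :* (y :- x)) refl x y z)

  *-mono-≤ : ∀ {x y u v} → 0# ≤ x → x ≤ y → 0# ≤ u → u ≤ v → x * u ≤ y * v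
  *-mono-≤ {x} {y} {u} {v} 0≤x x≤y 0≤u u≤v = begin
    x * u  ≤⟨ *-monoˡ-≤ 0≤x u≤v ⟩
    x * v  ≈⟨ *-comm x v ⟩
    v * x  ≤⟨ *-monoˡ-≤ (≤-trans 0≤u u≤v) x≤y ⟩
    v * y  ≈⟨ *-comm v y ⟩
    y * v  ∎

  *-monoˡ-< : ∀ {z x y} → 0# < z → x < y → z * x < z * y
  *-monoˡ-< {z} {x} {y} 0<z x<y = 0<d⇒x<x+d (*-pos 0<z (x<y⇒0<y-x x<y))
    (solve 3 (λ x y z → z :* y := z :* x :+ z :* (y :- x)) refl x y z)

  *-cancelˡ-< : ∀ {z x y} → 0# < z → z * x < z * y → x < y
  *-cancelˡ-< {z} {x} {y} 0<z zx<zy = begin-strict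
    x            ≈⟨ cancel x ⟨
    w * (z * x)  <⟨ *-monoˡ-< 0<w zx<zy ⟩
    w * (z * y)  ≈⟨ cancel y ⟩
    y            ∎
    where
    w : Carrier
    w = proj₁ (pos-inverse 0<z)
    0<w : 0# < w
    0<w = proj₁ (proj₂ (pos-inverse 0<z))
    zw≈1 : z * w ≈ 1#
    zw≈1 = proj₂ (proj₂ (pos-inverse 0<z))
    cancel : ∀ x → w * (z * x) ≈ x
    cancel x = trans (solve 3 (λ x w z → w :* (z :* x) := (z :* w) :* x) refl x w z)
                     (trans (*-congʳ zw≈1) (*-identityˡ x))

  x²-mono-< : ∀ {x y} → 0# ≤ x → x < y → x * x < y * y
  x²-mono-< {x} {y} 0≤x x<y = begin-strict
    x * x  ≤⟨ *-monoˡ-≤ 0≤x (<⇒≤ x<y) ⟩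
    x * y  ≈⟨ *-comm x y ⟩
    y * x  <⟨ *-monoˡ-< (≤-<-trans 0≤x x<y) x<y ⟩
    y * y  ∎

  -- Plays the part of extracting square roots: bounds are computed for squares and brought back
  -- through this lemma.
  x²-cancel-≤ : ∀ {x y} → 0# ≤ y → x * x ≤ y * y → x ≤ y
  x²-cancel-≤ 0≤y x²≤y² y<x = x²≤y² (x²-mono-< 0≤y y<x)

  ·-nonneg : ∀ n {x} → 0# ≤ x → 0# ≤ n · x
  ·-nonneg zero    0≤x = ≤-refl
  ·-nonneg (suc n) 0≤x = +-nonneg 0≤x (·-nonneg n 0≤x)

  ^-nonneg : ∀ n {x} → 0# ≤ x → 0# ≤ x ^ n
  ^-nonneg zero    0≤x = 0≤1
  ^-nonneg (suc n) 0≤x = *-nonneg 0≤x (^-nonneg n 0≤x)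

  ^-decreasing : ∀ {x} → 0# ≤ x → x ≤ 1# → ∀ m n → x ^ (m ℕ.+ n) ≤ x ^ n
  ^-decreasing 0≤x x≤1 zero    n = ≤-refl
  ^-decreasing {x} 0≤x x≤1 (suc m) n = begin
    x * x ^ (m ℕ.+ n)   ≤⟨ *-mono-≤ 0≤x x≤1 (^-nonneg (m ℕ.+ n) 0≤x) ≤-refl ⟩
    1# * x ^ (m ℕ.+ n)  ≈⟨ *-identityˡ _ ⟩
    x ^ (m ℕ.+ n)       ≤⟨ ^-decreasing 0≤x x≤1 m n ⟩
    x ^ n               ∎

  -- Bernoulli's inequality for 1/x.
  x^n[1+n[1-x]]≤1 : ∀ {x} → 0# ≤ x → x ≤ 1# → ∀ n → x ^ n * (1# + n · (1# - x)) ≤ 1#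
  x^n[1+n[1-x]]≤1 0≤x x≤1 zero    = ≤-reflexive (solve 0 (con 1ℤ :* (con 1ℤ :+ con 0ℤ) := con 1ℤ) refl)
  x^n[1+n[1-x]]≤1 {x} 0≤x x≤1 (suc n) = begin
    x * x ^ n * (1# + (δ + n · δ))  ≤⟨ 0≤d⇒x≤x+d
      (*-nonneg (^-nonneg n 0≤x) (*-nonneg 0≤δ (·-nonneg (suc n) 0≤δ)))
      (solve 3 (λ x u v →
         u :* (con 1ℤ :+ v) :=
         x :* u :* (con 1ℤ :+ ((con 1ℤ :- x) :+ v)) :+ u :* ((con 1ℤ :- x) :* ((con 1ℤ :- x) :+ v)))
         refl x (x ^ n) (n · δ)) ⟩
    x ^ n * (1# + n · δ)            ≤⟨ x^n[1+n[1-x]]≤1 0≤x x≤1 n ⟩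
    1#                              ∎
    where
    δ : Carrier
    δ = 1# - x
    0≤δ : 0# ≤ δ
    0≤δ = x≤y⇒0≤y-x x≤1

  -- With δ = 1 - x, Bernoulli's inequality bounds b x^N by b / (1 + N δ), which the Archimedean
  -- property makes smaller than ε.
  geometric-null : ∀ {x} → 0# ≤ x → x < 1# → ∀ {b ε} → 0# ≤ b → 0# < ε →
    ∃[ N ] ∀ n → N ℕ.≤ n → b * x ^ n < ε
  geometric-null {x} 0≤x x<1 {b} {ε} 0≤b 0<ε =
    N , λ n N≤n → ≤-<-trans (decreasing n N≤n) (*-cancelˡ-< 0<K Kbx^N<Kε)
    where
    δ : Carrier
    δ = 1# - x
    0<δ : 0# < δ
    0<δ = x<y⇒0<y-x x<1
    δε-inverse = pos-inverse (*-pos 0<δ 0<ε)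
    w : Carrier
    w = proj₁ δε-inverse
    N : ℕ
    -- `w` is 1 / (δ ε), so that `N` exceeds b / (δ ε), which gives b < N δ ε.
    N = proj₁ (archimedean (b * w))
    K : Carrier
    K = 1# + N · δ
    0<K : 0# < K
    0<K = +-pos-nonneg 0<1 (·-nonneg N (<⇒≤ 0<δ))
    decreasing : ∀ n → N ℕ.≤ n → b * x ^ n ≤ b * x ^ N
    decreasing n N≤n = *-monoˡ-≤ 0≤b (≡.subst (λ m → x ^ m ≤ x ^ N) (ℕ.m∸n+n≡m N≤n)
      (^-decreasing 0≤x (<⇒≤ x<1) (n ℕ.∸ N) N))
    Kbx^N<Kε : K * (b * x ^ N) < K * ε
    Kbx^N<Kε = begin-strict
      K * (b * x ^ N)          ≈⟨ solve 3 (λ K b u → K :* (b :* u) := b :* (u :* K)) refl K b (x ^ N) ⟩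
      b * (x ^ N * K)          ≤⟨ *-monoˡ-≤ 0≤b (x^n[1+n[1-x]]≤1 0≤x (<⇒≤ x<1) N) ⟩
      b * 1#                   ≈⟨ *-congˡ (sym (proj₂ (proj₂ δε-inverse))) ⟩
      b * (δ * ε * w)          ≈⟨ solve 4 (λ b w d e → b :* (d :* e :* w) := d :* e :* (b :* w)) refl b w δ ε ⟩
      δ * ε * (b * w)          <⟨ *-monoˡ-< (*-pos 0<δ 0<ε) (proj₂ (archimedean (b * w))) ⟩
      δ * ε * N · 1#           ≈⟨ solve 3 (λ d e n → d :* e :* n := (n :* d) :* e) refl δ ε (N · 1#) ⟩
      (N · 1# * δ) * ε         ≈⟨ *-congʳ (trans (×-assoc-* N 1# δ) (×-congʳ N (*-identityˡ δ))) ⟩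
      N · δ * ε                ≤⟨ 0≤d⇒x≤x+d (<⇒≤ 0<ε) (solve 2 (λ n e → (con 1ℤ :+ n) :* e := n :* e :+ e) refl (N · δ) ε) ⟩
      K * ε                    ∎

module RingIdentities {c ℓ} (A : CommutativeRing c ℓ) where
  open CommutativeRing A
  open IntegerSolver A

  +-telescope : ∀ x y z → (y - x) + (z - y) ≈ z - x
  +-telescope = solve 3 (λ x y z → (y :- x) :+ (z :- y) := z :- x) refl

  -‿telescope : ∀ x y z → (x - z) - (y - z) ≈ x - y
  -‿telescope = solve 3 (λ x y z → (x :- z) :- (y :- z) := x :- y) refl

  neg-telescope : ∀ x y z → - (y - x) + (y - z) ≈ x - z
  neg-telescope = solve 3 (λ x y z → :- (y :- x) :+ (y :- z) := x :- z) refl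

-- Bounds on complex moduli and limits with a geometric rate.

module ComplexBounds {ℓ ℓ₁ ℓ₂ ℓ₃} (R : Reals ℓ ℓ₁ ℓ₂ ℓ₃) where
  open Complex R
  module ℝ = RealOrder R
  open ℝ using (_≤_; _:=_; _:+_; _:*_; _:-_; :-_; con)
  open RingIdentities commutativeRing

  ∣∣²-* : ∀ u v → ∣ u * v ∣² ℝ.≈ ∣ u ∣² ℝ.* ∣ v ∣²
  ∣∣²-* (a +i b) (d +i e) = ℝ.solve 4 (λ a b d e →
    (a :* d :- b :* e) :* (a :* d :- b :* e) :+ (a :* e :+ b :* d) :* (a :* e :+ b :* d)
      := (a :* a :+ b :* b) :* (d :* d :+ e :* e)) ℝ.refl a b d e

  ∣∣²-cong : ∀ {u v} → u ≈ v → ∣ u ∣² ℝ.≈ ∣ v ∣²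
  ∣∣²-cong (p , q) = ℝ.+-cong (ℝ.*-cong p p) (ℝ.*-cong q q)

  ∣∣²-nonneg : ∀ w → ℝ.0# ≤ ∣ w ∣²
  ∣∣²-nonneg w = ℝ.+-nonneg (ℝ.x²-nonneg (re w)) (ℝ.x²-nonneg (im w))

  infix 4 _≲_
  -- The relation |w| ≤ r without a square root. The sign of `r` is carried along because comparing
  -- squares is meaningful only for nonnegative bounds.
  record _≲_ (w : ℂ) (r : ℝ.Carrier) : Set ℓ₃ where
    constructor bound
    field
      nonneg  : ℝ.0# ≤ r
      ∣∣²≤    : ∣ w ∣² ≤ r ℝ.* r
  open _≲_ public

  open ℝ.≤-Reasoning

  ≲-cong : ∀ {u v r} → u ≈ v → u ≲ r → v ≲ r
  ≲-cong u≈v (bound 0≤r u≤r) =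
    bound 0≤r (ℝ.≤-trans (ℝ.≤-reflexive (ℝ.sym (∣∣²-cong u≈v))) u≤r)

  ≲-mono : ∀ {w r s} → r ≤ s → w ≲ r → w ≲ s
  ≲-mono r≤s (bound 0≤r w≤r) =
    bound (ℝ.≤-trans 0≤r r≤s) (ℝ.≤-trans w≤r (ℝ.*-mono-≤ 0≤r r≤s 0≤r r≤s))

  -- The cross term is bounded by the Cauchy–Schwarz inequality.
  ≲-+ : ∀ {u v r s} → u ≲ r → v ≲ s → u + v ≲ r ℝ.+ s
  ≲-+ {u@(a +i b)} {v@(d +i e)} {r} {s} (bound 0≤r u≤r) (bound 0≤s v≤s) = bound (ℝ.+-nonneg 0≤r 0≤s) (begin
    ∣ u + v ∣²                                ≈⟨ ℝ.solve 4 (λ a b d e →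
      (a :+ d) :* (a :+ d) :+ (b :+ e) :* (b :+ e) :=
      (a :* a :+ b :* b) :+ (d :* d :+ e :* e) :+ ((a :* d :+ b :* e) :+ (a :* d :+ b :* e))) ℝ.refl a b d e ⟩
    ∣ u ∣² ℝ.+ ∣ v ∣² ℝ.+ (dot ℝ.+ dot)       ≤⟨ ℝ.+-mono-≤ (ℝ.+-mono-≤ u≤r v≤s) (ℝ.+-mono-≤ dot≤rs dot≤rs) ⟩
    r ℝ.* r ℝ.+ s ℝ.* s ℝ.+ (r ℝ.* s ℝ.+ r ℝ.* s)  ≈⟨ ℝ.solve 2 (λ r s →
      r :* r :+ s :* s :+ (r :* s :+ r :* s) := (r :+ s) :* (r :+ s)) ℝ.refl r s ⟩
    (r ℝ.+ s) ℝ.* (r ℝ.+ s)                   ∎)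
    where
    dot : ℝ.Carrier
    dot = a ℝ.* d ℝ.+ b ℝ.* e
    dot≤rs : dot ≤ r ℝ.* s
    dot≤rs = ℝ.x²-cancel-≤ (ℝ.*-nonneg 0≤r 0≤s) (begin
      dot ℝ.* dot              ≤⟨ ℝ.0≤d⇒x≤x+d (ℝ.x²-nonneg (a ℝ.* e ℝ.- b ℝ.* d)) (ℝ.solve 4 (λ a b d e →
        (a :* a :+ b :* b) :* (d :* d :+ e :* e) :=
        (a :* d :+ b :* e) :* (a :* d :+ b :* e) :+ (a :* e :- b :* d) :* (a :* e :- b :* d)) ℝ.refl a b d e) ⟩
      ∣ u ∣² ℝ.* ∣ v ∣²        ≤⟨ ℝ.*-mono-≤ (∣∣²-nonneg u) u≤r (∣∣²-nonneg v) v≤s ⟩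
      (r ℝ.* r) ℝ.* (s ℝ.* s)  ≈⟨ ℝ.solve 2 (λ r s → (r :* r) :* (s :* s) := (r :* s) :* (r :* s)) ℝ.refl r s ⟩
      (r ℝ.* s) ℝ.* (r ℝ.* s)  ∎)

  ≲-* : ∀ {u v r s} → u ≲ r → v ≲ s → u * v ≲ r ℝ.* s
  ≲-* {u} {v} {r} {s} (bound 0≤r u≤r) (bound 0≤s v≤s) = bound (ℝ.*-nonneg 0≤r 0≤s) (begin
    ∣ u * v ∣²               ≈⟨ ∣∣²-* u v ⟩
    ∣ u ∣² ℝ.* ∣ v ∣²        ≤⟨ ℝ.*-mono-≤ (∣∣²-nonneg u) u≤r (∣∣²-nonneg v) v≤s ⟩
    (r ℝ.* r) ℝ.* (s ℝ.* s)  ≈⟨ ℝ.solve 2 (λ r s → (r :* r) :* (s :* s) := (r :* s) :* (r :* s)) ℝ.refl r s ⟩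
    (r ℝ.* s) ℝ.* (r ℝ.* s)  ∎)

  ∣∣²-neg : ∀ w → ∣ - w ∣² ℝ.≈ ∣ w ∣²
  ∣∣²-neg (a +i b) =
    ℝ.solve 2 (λ a b → (:- a) :* (:- a) :+ (:- b) :* (:- b) := a :* a :+ b :* b) ℝ.refl a b

  ≲-neg : ∀ {w r} → w ≲ r → - w ≲ r
  ≲-neg {w} (bound 0≤r w≤r) = bound 0≤r (ℝ.≤-trans (ℝ.≤-reflexive (∣∣²-neg w)) w≤r)

  ≲-- : ∀ {u v r s} → u ≲ r → v ≲ s → u - v ≲ r ℝ.+ s
  ≲-- u≲r v≲s = ≲-+ u≲r (≲-neg v≲s)

  ≲-fromℝ : ∀ {r} → ℝ.0# ≤ r → fromℝ r ≲ r
  ≲-fromℝ {r} 0≤r = bound 0≤r (ℝ.≤-reflexive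
    (ℝ.solve 1 (λ r → r :* r :+ con 0ℤ :* con 0ℤ := r :* r) ℝ.refl r))

  0≲ : ∀ {r} → ℝ.0# ≤ r → 0# ≲ r
  0≲ 0≤r = ≲-mono 0≤r (≲-fromℝ ℝ.≤-refl)

  1≲1 : 1# ≲ ℝ.1#
  1≲1 = ≲-fromℝ ℝ.0≤1

  ≲1-* : ∀ {u v} → u ≲ ℝ.1# → v ≲ ℝ.1# → u * v ≲ ℝ.1#
  ≲1-* u≲1 v≲1 = ≲-mono (ℝ.≤-reflexive (ℝ.*-identityˡ _)) (≲-* u≲1 v≲1)

  ≲1-^ : ∀ {w} n → w ≲ ℝ.1# → w ^ n ≲ ℝ.1#
  ≲1-^ zero    w≲1 = 1≲1
  ≲1-^ (suc n) w≲1 = ≲1-* w≲1 (≲1-^ n w≲1)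

  -- A majorant of |w| that is polynomial in `∣ w ∣²`; it serves where some finite bound on a fixed
  -- number is enough.
  ≲-self : ∀ w → w ≲ ℝ.1# ℝ.+ ∣ w ∣²
  ≲-self w = bound (ℝ.+-nonneg ℝ.0≤1 0≤m) (ℝ.0≤d⇒x≤x+d
    (ℝ.+-nonneg (ℝ.+-nonneg ℝ.0≤1 0≤m) (ℝ.x²-nonneg ∣ w ∣²))
    (ℝ.solve 1 (λ m → (con 1ℤ :+ m) :* (con 1ℤ :+ m) := m :+ (con 1ℤ :+ m :+ m :* m)) ℝ.refl ∣ w ∣²))
    where
    0≤m = ∣∣²-nonneg w

  ≲⇒∣∣< : ∀ {w r ε} → w ≲ r → r ℝ.< ε → ∣ w ∣< ε
  ≲⇒∣∣< (bound 0≤r w≤r) r<ε = ℝ.≤-<-trans 0≤r r<ε , ℝ.≤-<-trans w≤r (ℝ.x²-mono-< 0≤r r<ε)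

  ∣∣<⇒≲ : ∀ {w r} → ∣ w ∣< r → w ≲ r
  ∣∣<⇒≲ (0<r , w<r) = bound (ℝ.<⇒≤ 0<r) (ℝ.<⇒≤ w<r)

  x²≤r²⇒∣x∣<ε : ∀ {x r ε} → ℝ.0# ≤ r → x ℝ.* x ≤ r ℝ.* r → r ℝ.< ε → ℝ.∣ x ∣< ε
  x²≤r²⇒∣x∣<ε {x} {r} {ε} 0≤r x²≤r² r<ε =
      ℝ.<-respʳ-≈ (ℝ.-‿involutive x) (ℝ.neg-mono-< (ℝ.≤-<-trans (ℝ.x²-cancel-≤ 0≤r
        (ℝ.≤-trans (ℝ.≤-reflexive (ℝ.solve 1 (λ x → (:- x) :* (:- x) := x :* x) ℝ.refl x)) x²≤r²)) r<ε))
    , ℝ.≤-<-trans (ℝ.x²-cancel-≤ 0≤r x²≤r²) r<ε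

  ∣x∣<ε⇒x²≤ε² : ∀ {x ε} → ℝ.∣ x ∣< ε → x ℝ.* x ≤ ε ℝ.* ε
  ∣x∣<ε⇒x²≤ε² {x} {ε} (-ε<x , x<ε) = ℝ.0≤d⇒x≤x+d
    (ℝ.*-nonneg (ℝ.x≤y⇒0≤y-x (ℝ.<⇒≤ x<ε)) (ℝ.x≤y⇒0≤y-x (ℝ.<⇒≤ -ε<x)))
    (ℝ.solve 2 (λ x e → e :* e := x :* x :+ (e :- x) :* (x :- :- e)) ℝ.refl x ε)

  ≲⇒∣re∣< : ∀ {w r ε} → w ≲ r → r ℝ.< ε → ℝ.∣ re w ∣< ε
  ≲⇒∣re∣< {w} (bound 0≤r w≤r) =
    x²≤r²⇒∣x∣<ε 0≤r (ℝ.≤-trans (ℝ.0≤d⇒x≤x+d (ℝ.x²-nonneg (im w)) ℝ.refl) w≤r)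

  ≲⇒∣im∣< : ∀ {w r ε} → w ≲ r → r ℝ.< ε → ℝ.∣ im w ∣< ε
  ≲⇒∣im∣< {w} (bound 0≤r w≤r) =
    x²≤r²⇒∣x∣<ε 0≤r (ℝ.≤-trans (ℝ.0≤d⇒x≤x+d (ℝ.x²-nonneg (re w)) (ℝ.+-comm _ _)) w≤r)

  module Geometric (θ : ℝ.Carrier) (0<θ : ℝ.0# ℝ.< θ) (θ<1 : θ ℝ.< ℝ.1#) where

    0≤θ : ℝ.0# ≤ θ
    0≤θ = ℝ.<⇒≤ 0<θ

    θ≤1 : θ ≤ ℝ.1#
    θ≤1 = ℝ.<⇒≤ θ<1

    θ^-nonneg : ∀ n → ℝ.0# ≤ θ ℝ.^ n
    θ^-nonneg n = ℝ.^-nonneg n 0≤θ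

    θ^-pos : ∀ n → ℝ.0# ℝ.< θ ℝ.^ n
    θ^-pos zero    = ℝ.0<1
    θ^-pos (suc n) = ℝ.*-pos 0<θ (θ^-pos n)

    D-inverse = ℝ.pos-inverse (ℝ.x<y⇒0<y-x θ<1)

    -- The sum 1 / (1 - θ) of the geometric series.
    D : ℝ.Carrier
    D = proj₁ D-inverse

    0≤D : ℝ.0# ≤ D
    0≤D = ℝ.<⇒≤ (proj₁ (proj₂ D-inverse))

    [1-θ]D≈1 : (ℝ.1# ℝ.- θ) ℝ.* D ℝ.≈ ℝ.1#
    [1-θ]D≈1 = proj₂ (proj₂ D-inverse)

    -- The induction on `m` closes only for the exact geometric sum, with θ^n - θ^(m+n) in place of
    -- θ^n; the subtracted term is dropped afterwards.
    increments-≲ : ∀ (u : ℕ → ℂ) C → ℝ.0# ≤ C → (∀ n → u (suc n) - u n ≲ C ℝ.* θ ℝ.^ n) →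
      ∀ m n → u (m ℕ.+ n) - u n ≲ C ℝ.* D ℝ.* θ ℝ.^ n
    increments-≲ u C 0≤C inc m n = ≲-mono (ℝ.0≤d⇒x≤x+d
      (ℝ.*-nonneg 0≤CD (θ^-nonneg (m ℕ.+ n)))
      (ℝ.solve 3 (λ b x y → b :* x := b :* (x :- y) :+ b :* y) ℝ.refl (C ℝ.* D) (θ ℝ.^ n) (θ ℝ.^ (m ℕ.+ n))))
      (telescope m)
      where
      0≤CD : ℝ.0# ≤ C ℝ.* D
      0≤CD = ℝ.*-nonneg 0≤C 0≤D
      telescope : ∀ m → u (m ℕ.+ n) - u n ≲ C ℝ.* D ℝ.* (θ ℝ.^ n ℝ.- θ ℝ.^ (m ℕ.+ n))
      telescope zero = ≲-cong (sym (-‿inverseʳ (u n))) (0≲ (ℝ.≤-reflexive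
        (ℝ.solve 2 (λ b x → con 0ℤ := b :* (x :- x)) ℝ.refl (C ℝ.* D) (θ ℝ.^ n))))
      telescope (suc m) = ≲-cong
        (+-telescope (u n) (u (m ℕ.+ n)) (u (suc m ℕ.+ n)))
        (≲-mono (ℝ.≤-reflexive step) (≲-+ (telescope m) (inc (m ℕ.+ n))))
        where
        y = θ ℝ.^ (m ℕ.+ n)
        step : C ℝ.* D ℝ.* (θ ℝ.^ n ℝ.- y) ℝ.+ C ℝ.* y ℝ.≈ C ℝ.* D ℝ.* (θ ℝ.^ n ℝ.- θ ℝ.* y)
        -- The new summand is multiplied by `(1 - θ) * D`, which equals one, so that it acquires the
        -- common factor `C * D`.
        step = ℝ.trans (ℝ.+-congˡ (ℝ.*-congˡ (ℝ.trans (ℝ.sym (ℝ.*-identityˡ y)) (ℝ.*-congʳ (ℝ.sym [1-θ]D≈1)))))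
          (ℝ.solve 5 (λ C D x y t →
            C :* D :* (x :- y) :+ C :* ((con 1ℤ :- t) :* D :* y) := C :* D :* (x :- t :* y))
            ℝ.refl C D (θ ℝ.^ n) y θ)

    -- Completeness supplies a limit without a rate. The rate is recovered by comparing `u n` with
    -- one later term `u m` that lies within θ^n of the limit, which is why `B` grows by one. The
    -- index `m = N + n` is late enough and also of the form that `inc` accepts.
    converges : ∀ (u : ℕ → ℂ) B → ℝ.0# ≤ B → (∀ m n → u (m ℕ.+ n) - u n ≲ B ℝ.* θ ℝ.^ n) →
      ∃[ l ] ∀ n → u n - l ≲ (B ℝ.+ ℝ.1#) ℝ.* θ ℝ.^ n
    converges u B 0≤B inc = l , tail
      where
      2B = B ℝ.+ B
      close : ∀ N m n → N ℕ.≤ m → N ℕ.≤ n → u m - u n ≲ 2B ℝ.* θ ℝ.^ N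
      close N m n N≤m N≤n = ≲-cong
        (-‿telescope (u m) (u n) (u N))
        (≲-mono (ℝ.≤-reflexive (ℝ.sym (ℝ.distribʳ _ _ _))) (≲-- (from m N≤m) (from n N≤n)))
        where
        from : ∀ m → N ℕ.≤ m → u m - u N ≲ B ℝ.* θ ℝ.^ N
        from m N≤m = ≡.subst (λ k → u k - u N ≲ B ℝ.* θ ℝ.^ N) (ℕ.m∸n+n≡m N≤m) (inc (m ℕ.∸ N) N)
      cauchy : (f : ℂ → ℝ.Carrier) →
        (∀ {u v r ε} → u - v ≲ r → r ℝ.< ε → ℝ.∣ f u ℝ.- f v ∣< ε) →
        ∀ ε → ℝ.0# ℝ.< ε → ∃[ N ] ∀ m n → N ℕ.≤ m → N ℕ.≤ n → ℝ.∣ f (u m) ℝ.- f (u n) ∣< ε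
      cauchy f f-bound ε 0<ε = proj₁ null , λ m n N≤m N≤n →
        f-bound (close N m n N≤m N≤n) (proj₂ null N ℕ.≤-refl)
        where
        null = ℝ.geometric-null 0≤θ θ<1 (ℝ.+-nonneg 0≤B 0≤B) 0<ε
        N = proj₁ null
      re-limit = ℝ.complete (re ∘ u) (cauchy re (λ {u} {v} → ≲⇒∣re∣< {u - v}))
      im-limit = ℝ.complete (im ∘ u) (cauchy im (λ {u} {v} → ≲⇒∣im∣< {u - v}))
      l : ℂ
      l = proj₁ re-limit +i proj₁ im-limit
      half-inverse = ℝ.pos-inverse (ℝ.+-pos-nonneg ℝ.0<1 ℝ.0≤1)
      half = proj₁ half-inverse
      near : ∀ ε → ℝ.0# ℝ.< ε → ∃[ N ] ∀ m → N ℕ.≤ m → u m - l ≲ ε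
      near ε 0<ε = N , λ m N≤m → bound (ℝ.<⇒≤ 0<ε) (begin
        ∣ u m - l ∣²
          ≤⟨ ℝ.+-mono-≤
               (∣x∣<ε⇒x²≤ε² (proj₂ (proj₂ re-limit h 0<h) m (ℕ.≤-trans (ℕ.m≤m⊔n _ _) N≤m)))
               (∣x∣<ε⇒x²≤ε² (proj₂ (proj₂ im-limit h 0<h) m (ℕ.≤-trans (ℕ.m≤n⊔m _ _) N≤m))) ⟩
        h ℝ.* h ℝ.+ h ℝ.* h
          ≤⟨ ℝ.0≤d⇒x≤x+d (ℝ.+-nonneg (ℝ.x²-nonneg h) (ℝ.x²-nonneg h)) (ℝ.solve 1 (λ h →
               (h :+ h) :* (h :+ h) := (h :* h :+ h :* h) :+ (h :* h :+ h :* h)) ℝ.refl h) ⟩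
        (h ℝ.+ h) ℝ.* (h ℝ.+ h)
          ≈⟨ ℝ.*-cong h+h≈ε h+h≈ε ⟩
        ε ℝ.* ε ∎)
        where
        -- Half of `ε` for each coordinate suffices, because `h * h + h * h` is at most
        -- `(h + h) * (h + h)`.
        h = half ℝ.* ε
        0<h : ℝ.0# ℝ.< h
        0<h = ℝ.*-pos (proj₁ (proj₂ half-inverse)) 0<ε
        h+h≈ε : h ℝ.+ h ℝ.≈ ε
        h+h≈ε = ℝ.trans (ℝ.solve 2 (λ a e → a :* e :+ a :* e := (con 1ℤ :+ con 1ℤ) :* a :* e) ℝ.refl half ε)
          (ℝ.trans (ℝ.*-congʳ (proj₂ (proj₂ half-inverse))) (ℝ.*-identityˡ ε))
        N = proj₁ (proj₂ re-limit h 0<h) ℕ.⊔ proj₁ (proj₂ im-limit h 0<h)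
      tail : ∀ n → u n - l ≲ (B ℝ.+ ℝ.1#) ℝ.* θ ℝ.^ n
      tail n = ≲-cong
        (neg-telescope (u n) (u m) l)
        (≲-mono (ℝ.≤-reflexive (ℝ.sym (ℝ.trans (ℝ.distribʳ _ _ _) (ℝ.+-congˡ (ℝ.*-identityˡ _)))))
          (≲-+ (≲-neg (inc N n)) (proj₂ (near (θ ℝ.^ n) (θ^-pos n)) m (ℕ.m≤m+n N n))))
        where
        N = proj₁ (near (θ ℝ.^ n) (θ^-pos n))
        m = N ℕ.+ n

-- Singular step sets and weighted sums over quadrant walks.

length-filter-map : ∀ {a b p} {A : Set a} {B : Set b} {P : Pred B p} (P? : Decidable P) (f : A → B) xs →
  length (filter P? (map f xs)) ≡ length (filter (P? ∘ f) xs)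
length-filter-map P? f [] = ≡.refl
length-filter-map P? f (x ∷ xs) with P? (f x)
... | yes _ = ≡.cong suc (length-filter-map P? f xs)
... | no  _ = length-filter-map P? f xs

quadrantWalk⇒inQuadrant : ∀ {p e} w → QuadrantWalk p w e → InQuadrant p
quadrantWalk⇒inQuadrant []      = proj₁
quadrantWalk⇒inQuadrant (s ∷ w) = proj₁

data Positive : Point → Set where
  north     : Positive (0ℤ , 1ℤ)
  east      : Positive (1ℤ , 0ℤ)
  northeast : Positive (1ℤ , 1ℤ)

northwest southeast : Point
northwest = -1ℤ , 1ℤ
southeast = 1ℤ , -1ℤ

data SingularShape : StepSet → Set where
  nw∷se∷ : ∀ {S} → All Positive S → SingularShape (northwest ∷ southeast ∷ S)
  se∷nw∷ : ∀ {S} → All Positive S → SingularShape (southeast ∷ northwest ∷ S)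

positivePart : ∀ {S} → SingularShape S → StepSet
positivePart (nw∷se∷ {S} _) = S
positivePart (se∷nw∷ {S} _) = S

positivePart-positive : ∀ {S} (shape : SingularShape S) → All Positive (positivePart shape)
positivePart-positive (nw∷se∷ pos) = pos
positivePart-positive (se∷nw∷ pos) = pos

module FiniteSums {c ℓ} (A : CommutativeRing c ℓ) where
  open CommutativeRing A
  open Algebra.Definitions.RawSemiring (Semiring.rawSemiring semiring) using (sum)
  open IntegerSolver A

  ∑<_ : ℕ → (ℕ → Carrier) → Carrier
  (∑< n) f = sum {n} (f ∘ toℕ)

  sumList : List Carrier → Carrier
  sumList = foldr _+_ 0#

  ∑<-cong-< : ∀ n {f g : ℕ → Carrier} → (∀ {i} → i ℕ.< n → f i ≈ g i) → (∑< n) f ≈ (∑< n) g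
  ∑<-cong-< zero    f≈g = refl
  ∑<-cong-< (suc n) f≈g = +-cong (f≈g (ℕ.s≤s ℕ.z≤n)) (∑<-cong-< n (f≈g ∘ ℕ.s≤s))

  ∑<-cong : ∀ n {f g : ℕ → Carrier} → (∀ i → f i ≈ g i) → (∑< n) f ≈ (∑< n) g
  ∑<-cong n f≈g = ∑<-cong-< n λ {i} _ → f≈g i

  ∑<-zero : ∀ n → (∑< n) (λ _ → 0#) ≈ 0#
  ∑<-zero zero    = refl
  ∑<-zero (suc n) = trans (+-identityˡ _) (∑<-zero n)

  ∑<-suc : ∀ n f → (∑< suc n) f ≈ (∑< n) f + f n
  ∑<-suc zero    f = +-comm _ _
  ∑<-suc (suc n) f = trans (+-congˡ (∑<-suc n (f ∘ suc))) (sym (+-assoc _ _ _))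

  ∑<-+ : ∀ n f g → (∑< n) (λ i → f i + g i) ≈ (∑< n) f + (∑< n) g
  ∑<-+ zero    f g = sym (+-identityˡ 0#)
  ∑<-+ (suc n) f g = trans (+-congˡ (∑<-+ n (f ∘ suc) (g ∘ suc)))
    (solve 4 (λ a b c d → (a :+ b) :+ (c :+ d) := (a :+ c) :+ (b :+ d)) refl _ _ _ _)

  ∑<-comm : ∀ m n (f : ℕ → ℕ → Carrier) →
    (∑< m) (λ i → (∑< n) (f i)) ≈ (∑< n) (λ j → (∑< m) (λ i → f i j))
  ∑<-comm zero    n f = sym (∑<-zero n)
  ∑<-comm (suc m) n f = trans (+-congˡ (∑<-comm m n (f ∘ suc))) (sym (∑<-+ n (f 0) (λ j → (∑< m) (λ i → f (suc i) j))))

  module _ {a} {B : Set a} where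
    sumList-cong : ∀ (L : List B) {f g : B → Carrier} → (∀ {s} → s ∈ L → f s ≈ g s) →
      sumList (map f L) ≈ sumList (map g L)
    sumList-cong []      f≈g = refl
    sumList-cong (s ∷ L) f≈g = +-cong (f≈g (here ≡.refl)) (sumList-cong L (f≈g ∘ there))

    sumList-+ : ∀ (L : List B) (f g : B → Carrier) →
      sumList (map (λ s → f s + g s) L) ≈ sumList (map f L) + sumList (map g L)
    sumList-+ []      f g = sym (+-identityˡ 0#)
    sumList-+ (s ∷ L) f g = trans (+-congˡ (sumList-+ L f g))
      (solve 4 (λ a b c d → (a :+ b) :+ (c :+ d) := (a :+ c) :+ (b :+ d)) refl _ _ _ _)

    sumList-* : ∀ (L : List B) k (f : B → Carrier) →
      sumList (map (λ s → k * f s) L) ≈ k * sumList (map f L)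
    sumList-* []      k f = sym (zeroʳ k)
    sumList-* (s ∷ L) k f = trans (+-congˡ (sumList-* L k f)) (sym (distribˡ k _ _))

  sumList-singular : ∀ {S} (shape : SingularShape S) (f : Point → Carrier) →
    sumList (map f S) ≈ f northwest + f southeast + sumList (map f (positivePart shape))
  sumList-singular (nw∷se∷ _) f = sym (+-assoc _ _ _)
  sumList-singular (se∷nw∷ _) f =
    solve 3 (λ a b c → a :+ (b :+ c) := b :+ a :+ c) refl _ _ _

module WalkSums {c ℓ} (A : CommutativeRing c ℓ) (S : StepSet) (z : CommutativeRing.Carrier A) where
  open CommutativeRing A
  open Algebra.Definitions.RawSemiring (Semiring.rawSemiring semiring) using (_^_) renaming (_×_ to _·_)
  open Algebra.Properties.Semiring.Mult semiring using (×-comm-*) renaming (×-homo-+ to ·-homo-+)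
  open FiniteSums A public
  open IntegerSolver A
  open Relation.Binary.Reasoning.Setoid setoid

  restrict : (Point → Carrier) → Point → Carrier
  restrict f p@(+ _ , + _) = f p
  restrict f _             = 0#

  restrict-cong : ∀ {f g} p → (InQuadrant p → f p ≈ g p) → restrict f p ≈ restrict g p
  restrict-cong (+ _      , + _     ) f≈g = f≈g (ℤ.+≤+ ℕ.z≤n , ℤ.+≤+ ℕ.z≤n)
  restrict-cong (+ _      , -[1+ _ ]) f≈g = refl
  restrict-cong (-[1+ _ ] , _       ) f≈g = refl

  restrict-in : ∀ f {p} → InQuadrant p → restrict f p ≡ f p
  restrict-in f { + _      , + _     } _       = ≡.refl
  restrict-in f { + _      , -[1+ _ ]} (_ , ())
  restrict-in f { -[1+ _ ] , _       } (() , _)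

  restrict-out : ∀ f {p} → ¬ InQuadrant p → restrict f p ≡ 0#
  restrict-out f { + _      , + _     } p∉Q = ⊥-elim (p∉Q (ℤ.+≤+ ℕ.z≤n , ℤ.+≤+ ℕ.z≤n))
  restrict-out f { + _      , -[1+ _ ]} _   = ≡.refl
  restrict-out f { -[1+ _ ] , _       } _   = ≡.refl

  restrict-+ : ∀ f g p → restrict (λ p → f p + g p) p ≈ restrict f p + restrict g p
  restrict-+ f g (+ _      , + _     ) = refl
  restrict-+ f g (+ _      , -[1+ _ ]) = sym (+-identityˡ 0#)
  restrict-+ f g (-[1+ _ ] , _       ) = sym (+-identityˡ 0#)

  restrict-* : ∀ k f p → restrict (λ p → k * f p) p ≈ k * restrict f p
  restrict-* k f (+ _      , + _     ) = refl
  restrict-* k f (+ _      , -[1+ _ ]) = sym (zeroʳ k)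
  restrict-* k f (-[1+ _ ] , _       ) = sym (zeroʳ k)

  -- E n f p is the sum of z^n f(e) over the n-step walks in the quadrant
  -- from p to some e.
  E : ℕ → (Point → Carrier) → Point → Carrier
  E zero    f = restrict f
  E (suc n) f = restrict (λ p → z * sumList (map (λ s → E n f (p ⊕ s)) S))

  lastStep : (Point → Carrier) → Point → Carrier
  lastStep f p = z * sumList (map (λ s → restrict f (p ⊕ s)) S)

  -- `E` unfolds a walk at its first step, as the counting function does, whereas the functional
  -- equation appends a step at the end. This lemma passes from one to the other.
  E-suc : ∀ n f p → E (suc n) f p ≈ E n (lastStep f) p
  E-suc zero    f p = refl
  E-suc (suc n) f p = restrict-cong p λ _ →
    *-congˡ (sumList-cong S λ {s} _ → E-suc n f (p ⊕ s))

  -- `D n p` is an invariant of walks that have `n` steps left at `p`; only endpoints satisfying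
  -- `D 0` enter the sum. It is applied with the trivial invariant and with confinement to a box.
  E-local : (D : ℕ → Point → Set) → (∀ {n p s} → s ∈ S → D (suc n) p → D n (p ⊕ s)) →
    ∀ {f g} → (∀ {p} → InQuadrant p → D 0 p → f p ≈ g p) →
    ∀ n {p} → D n p → E n f p ≈ E n g p
  E-local D step f≈g zero    {p} Dp = restrict-cong p λ p∈Q → f≈g p∈Q Dp
  E-local D step f≈g (suc n) {p} Dp = restrict-cong p λ _ →
    *-congˡ (sumList-cong S λ s∈S → E-local D step f≈g n (step s∈S Dp))

  E-cong : ∀ {f g} → (∀ {p} → InQuadrant p → f p ≈ g p) → ∀ n p → E n f p ≈ E n g p
  E-cong f≈g n p = E-local (λ _ _ → ⊤) _ (λ p∈Q _ → f≈g p∈Q) n {p} _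

  E-+ : ∀ f g n p → E n (λ p → f p + g p) p ≈ E n f p + E n g p
  E-+ f g zero    p = restrict-+ f g p
  E-+ f g (suc n) p = trans (restrict-cong p λ _ → trans
    (*-congˡ (trans (sumList-cong S λ {s} _ → E-+ f g n (p ⊕ s)) (sumList-+ S _ _)))
    (distribˡ z _ _)) (restrict-+ _ _ p)

  E-* : ∀ k f n p → E n (λ p → k * f p) p ≈ k * E n f p
  E-* k f zero    p = restrict-* k f p
  E-* k f (suc n) p = trans (restrict-cong p λ _ → trans
    (*-congˡ (trans (sumList-cong S λ {s} _ → E-* k f n (p ⊕ s)) (sumList-* S k _)))
    (solve 3 (λ z k w → z :* (k :* w) := k :* (z :* w)) refl z k _)) (restrict-* k _ p)

  E-zero : ∀ {f} → (∀ {p} → InQuadrant p → f p ≈ 0#) → ∀ n p → E n f p ≈ 0#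
  E-zero {f} f≈0 n p = begin
    E n f p                ≈⟨ E-cong (λ p∈Q → trans (f≈0 p∈Q) (sym (zeroˡ _))) n p ⟩
    E n (λ p → 0# * f p) p ≈⟨ E-* 0# f n p ⟩
    0# * E n f p           ≈⟨ zeroˡ _ ⟩
    0#                     ∎

  E-∑< : ∀ I (f : ℕ → Point → Carrier) n p →
    E n (λ p → (∑< I) (λ i → f i p)) p ≈ (∑< I) (λ i → E n (f i) p)
  E-∑< zero    f n p = E-zero (λ _ → refl) n p
  E-∑< (suc I) f n p = trans (E-+ _ _ n p) (+-congˡ (E-∑< I (f ∘ suc) n p))

  -- The Kronecker delta of two indices times `k`, defined by recursion on both so that it reduces
  -- in step with the sums over `i`.
  pick : ℕ → ℕ → Carrier → Carrier
  pick zero    zero    k = k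
  pick (suc a) (suc i) k = pick a i k
  pick zero    (suc _) k = 0#
  pick (suc _) zero    k = 0#

  pick-≡ : ∀ a {k} → pick a a k ≡ k
  pick-≡ zero    = ≡.refl
  pick-≡ (suc a) = pick-≡ a

  pick-≢ : ∀ a i {k} → ¬ a ≡ i → pick a i k ≡ 0#
  pick-≢ zero    zero    a≢i = ⊥-elim (a≢i ≡.refl)
  pick-≢ zero    (suc i) a≢i = ≡.refl
  pick-≢ (suc a) zero    a≢i = ≡.refl
  pick-≢ (suc a) (suc i) a≢i = pick-≢ a i (a≢i ∘ ≡.cong suc)

  pick-0 : ∀ a i → pick a i 0# ≡ 0#
  pick-0 zero    zero    = ≡.refl
  pick-0 zero    (suc i) = ≡.refl
  pick-0 (suc a) zero    = ≡.refl
  pick-0 (suc a) (suc i) = pick-0 a i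

  ∑<-pick-< : ∀ {a I} (g : ℕ → Carrier) → a ℕ.< I → (∑< I) (λ i → pick a i (g i)) ≈ g a
  ∑<-pick-< {zero}  {suc I} g _           = trans (+-congˡ (∑<-zero I)) (+-identityʳ _)
  ∑<-pick-< {suc a} {suc I} g (ℕ.s≤s a<I) = trans (+-identityˡ _) (∑<-pick-< (g ∘ suc) a<I)

  ∑<-pick-≥ : ∀ {a I} (g : ℕ → Carrier) → I ℕ.≤ a → (∑< I) (λ i → pick a i (g i)) ≈ 0#
  ∑<-pick-≥ {a}     {zero}  g _           = refl
  ∑<-pick-≥ {suc a} {suc I} g (ℕ.s≤s I≤a) = trans (+-identityˡ _) (∑<-pick-≥ (g ∘ suc) I≤a)

  indicator : ℕ → ℕ → Point → Carrier
  indicator i j (+ a , + b) = pick a i (pick b j 1#)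
  indicator i j _           = 0#

  indicator-≡ : ∀ i j → indicator i j (+ i , + j) ≡ 1#
  indicator-≡ i j = ≡.trans (pick-≡ i) (pick-≡ j)

  indicator-≢ : ∀ i j a b → ¬ _≡_ {A = Point} (+ a , + b) (+ i , + j) → indicator i j (+ a , + b) ≡ 0#
  indicator-≢ i j a b ≢ with a ℕ.≟ i
  ... | no  a≢i    = pick-≢ a i a≢i
  ... | yes ≡.refl = ≡.trans (≡.cong (pick a a) (pick-≢ b j λ { ≡.refl → ≢ ≡.refl })) (pick-0 a a)

  walks : List (List Point) → Point → ℕ → ℕ → ℕ
  walks W p i j = length (filter (λ w → quadrantWalk? p w (+ i , + j)) W)

  walks-out : ∀ W p i j → ¬ InQuadrant p → walks W p i j ≡ 0
  walks-out W p i j p∉Q =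
    ≡.cong length (filter-none _ (All.universal (λ w → p∉Q ∘ quadrantWalk⇒inQuadrant w) W))

  walks-∷ : ∀ W p s L i j → InQuadrant p →
    walks (cartesianProductWith _∷_ (s ∷ L) W) p i j
      ≡ walks W (p ⊕ s) i j ℕ.+ walks (cartesianProductWith _∷_ L W) p i j
  walks-∷ W p s L i j p∈Q = ≡.trans
    (≡.trans (≡.cong length (filter-++ P? (map (s ∷_) W) _)) (length-++ (filter P? (map (s ∷_) W))))
    (≡.cong (ℕ._+ walks (cartesianProductWith _∷_ L W) p i j) (≡.trans
      (length-filter-map P? (s ∷_) W)
      (≡.cong length (filter-≐ (P? ∘ (s ∷_)) (λ w → quadrantWalk? (p ⊕ s) w (+ i , + j))
        (proj₂ , (p∈Q ,_)) W))))
    where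
    P? = λ w → quadrantWalk? p w (+ i , + j)

  -- Both sides obey the same recursion on the first step. The case outside the quadrant, where both
  -- vanish, comes first; in the remaining case the requirement on the starting point can be
  -- cancelled from the walks.
  walks-E : ∀ n i j p → walks (stepSequences S n) p i j · z ^ n ≈ E n (indicator i j) p
  walks-E n i j p with inQuadrant? p
  walks-E n i j p | no p∉Q =
    trans (reflexive (≡.cong (_· z ^ n) (walks-out (stepSequences S n) p i j p∉Q))) (E-out n)
    where
    E-out : ∀ n → 0# ≈ E n (indicator i j) p
    E-out zero    = reflexive (≡.sym (restrict-out _ p∉Q))
    E-out (suc n) = reflexive (≡.sym (restrict-out _ p∉Q))
  walks-E zero i j p@(+ a , + b) | yes p∈Q with quadrantWalk? p [] (+ i , + j)
  ... | yes walk@(_ , ≡.refl) = begin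
    walks ([] ∷ []) p i j · 1#  ≡⟨ ≡.cong ((_· 1#) ∘ length)
      (filter-accept (λ w → quadrantWalk? p w p) {[]} {[]} walk) ⟩
    1# + 0#                     ≈⟨ +-identityʳ 1# ⟩
    1#                          ≡⟨ indicator-≡ i j ⟨
    indicator i j p             ∎
  ... | no ¬walk = begin
    walks ([] ∷ []) p i j · 1#  ≡⟨ ≡.cong ((_· 1#) ∘ length)
      (filter-reject (λ w → quadrantWalk? p w (+ i , + j)) {[]} {[]} ¬walk) ⟩
    0#                          ≡⟨ indicator-≢ i j a b (λ p≡e → ¬walk (p∈Q , p≡e)) ⟨
    indicator i j p             ∎
  walks-E (suc n) i j p | yes p∈Q = trans (firstStep S) (reflexive (≡.sym (restrict-in _ p∈Q)))
    where
    W = stepSequences S n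
    -- Only the list of first steps is generalised to `L` for the induction; the continuations `W`
    -- still use all of `S`.
    firstStep : ∀ L → walks (cartesianProductWith _∷_ L W) p i j · z ^ suc n
                        ≈ z * sumList (map (λ s → E n (indicator i j) (p ⊕ s)) L)
    firstStep [] = sym (zeroʳ z)
    firstStep (s ∷ L) = begin
      walks (cartesianProductWith _∷_ (s ∷ L) W) p i j · z ^ suc n
        ≡⟨ ≡.cong (_· z ^ suc n) (walks-∷ W p s L i j p∈Q) ⟩
      (walks W (p ⊕ s) i j ℕ.+ walks (cartesianProductWith _∷_ L W) p i j) · z ^ suc n
        ≈⟨ ·-homo-+ _ (walks W (p ⊕ s) i j) _ ⟩
      walks W (p ⊕ s) i j · z ^ suc n + walks (cartesianProductWith _∷_ L W) p i j · z ^ suc n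
        ≈⟨ +-cong (trans (sym (×-comm-* (walks W (p ⊕ s) i j) z (z ^ n))) (*-congˡ (walks-E n i j (p ⊕ s)))) (firstStep L) ⟩
      z * E n (indicator i j) (p ⊕ s) + z * sumList (map (λ s → E n (indicator i j) (p ⊕ s)) L)
        ≈⟨ distribˡ z _ _ ⟨
      z * sumList (map (λ s → E n (indicator i j) (p ⊕ s)) (s ∷ L)) ∎

-- Box sums of the generating function and the truncated functional equation.

SmallStep : Point → Set
SmallStep (i , j) = i ℤ.≤ 1ℤ × j ℤ.≤ 1ℤ

positive-small : ∀ {s} → Positive s → SmallStep s
positive-small north     = ℤ.+≤+ ℕ.z≤n , ℤ.≤-refl
positive-small east      = ℤ.≤-refl , ℤ.+≤+ ℕ.z≤n
positive-small northeast = ℤ.≤-refl , ℤ.≤-refl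

singular-small : ∀ {S} → SingularShape S → All SmallStep S
singular-small (nw∷se∷ pos) = (ℤ.-≤+ , ℤ.≤-refl) ∷ (ℤ.≤-refl , ℤ.-≤+) ∷ All.map positive-small pos
singular-small (se∷nw∷ pos) = (ℤ.≤-refl , ℤ.-≤+) ∷ (ℤ.-≤+ , ℤ.≤-refl) ∷ All.map positive-small pos

-- An n-step walk from p cannot leave the box [0,I) × [0,J).
Inside : ℕ → ℕ → ℕ → Point → Set
Inside I J n (i , j) = i ℤ.+ + n ℤ.< + I × j ℤ.+ + n ℤ.< + J

inside-⊕ : ∀ {I J n p s} → SmallStep s → Inside I J (suc n) p → Inside I J n (p ⊕ s)
inside-⊕ {n = n} {p} {s} (s₁≤1 , s₂≤1) (i< , j<) =
  ℤ.≤-<-trans (shift (proj₁ p) s₁≤1) i< , ℤ.≤-<-trans (shift (proj₂ p) s₂≤1) j<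
  where
  shift : ∀ i {k} → k ℤ.≤ 1ℤ → (i ℤ.+ k) ℤ.+ + n ℤ.≤ i ℤ.+ + suc n
  shift i {k} k≤1 = ≡.subst (ℤ._≤ i ℤ.+ + suc n) (≡.sym (ℤ.+-assoc i k (+ n)))
    (ℤ.+-monoʳ-≤ i (ℤ.+-monoˡ-≤ (+ n) k≤1))

module Monomials {c ℓ} (A : CommutativeRing c ℓ) (S : StepSet) (z : CommutativeRing.Carrier A) where
  open CommutativeRing A
  open Algebra.Definitions.RawSemiring (Semiring.rawSemiring semiring) using (_^_) renaming (_×_ to _·_)
  open Algebra.Properties.Semiring.Mult semiring using (×-comm-*)
  open WalkSums A S z public
  open IntegerSolver A
  open Relation.Binary.Reasoning.Setoid setoid

  origin : Point
  origin = 0ℤ , 0ℤ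

  monomial : Carrier → Carrier → Point → Carrier
  monomial x y (i , j) = x ^ ℤ.∣ i ∣ * y ^ ℤ.∣ j ∣

  -- The monomial cut off outside [0,I) × [0,J), written as a double sum so that it matches the
  -- partial sums of the triple series.
  box : Carrier → Carrier → ℕ → ℕ → Point → Carrier
  box x y I J p = (∑< I) (λ i → (∑< J) (λ j → x ^ i * y ^ j * indicator i j p))

  -- Interchanging the finite sums puts the length outermost; the tail in `n` can then be estimated
  -- independently of `I` and `J`.
  ∑q≈∑E : ∀ x y I J M →
    (∑< I) (λ i → (∑< J) (λ j → (∑< M) (λ n → q S i j n · (x ^ i * y ^ j * z ^ n))))
      ≈ (∑< M) (λ n → E n (box x y I J) origin)
  ∑q≈∑E x y I J M = begin
    (∑< I) (λ i → (∑< J) (λ j → (∑< M) (λ n → q S i j n · (x ^ i * y ^ j * z ^ n))))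
      ≈⟨ ∑<-cong I (λ i → ∑<-cong J (λ j → ∑<-cong M (λ n → summand i j n))) ⟩
    (∑< I) (λ i → (∑< J) (λ j → (∑< M) (λ n → F i j n)))
      ≈⟨ ∑<-cong I (λ i → ∑<-comm J M (F i)) ⟩
    (∑< I) (λ i → (∑< M) (λ n → (∑< J) (λ j → F i j n)))
      ≈⟨ ∑<-comm I M (λ i n → (∑< J) (λ j → F i j n)) ⟩
    (∑< M) (λ n → (∑< I) (λ i → (∑< J) (λ j → F i j n)))
      ≈⟨ ∑<-cong M (λ n → trans
           (E-∑< I (λ i p → (∑< J) (λ j → x ^ i * y ^ j * indicator i j p)) n origin)
           (∑<-cong I λ i → E-∑< J (λ j p → x ^ i * y ^ j * indicator i j p) n origin)) ⟨
    (∑< M) (λ n → E n (box x y I J) origin) ∎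
    where
    F : ℕ → ℕ → ℕ → Carrier
    F i j n = E n (λ p → x ^ i * y ^ j * indicator i j p) origin
    summand : ∀ i j n → q S i j n · (x ^ i * y ^ j * z ^ n) ≈ F i j n
    summand i j n = begin
      q S i j n · (x ^ i * y ^ j * z ^ n)             ≈⟨ ×-comm-* (q S i j n) _ _ ⟨
      x ^ i * y ^ j * q S i j n · z ^ n               ≈⟨ *-congˡ (walks-E n i j origin) ⟩
      x ^ i * y ^ j * E n (indicator i j) origin      ≈⟨ E-* _ (indicator i j) n origin ⟨
      F i j n                                         ∎

  ∑<-pick-comm : ∀ J a i (g : ℕ → Carrier) → (∑< J) (λ j → pick a i (g j)) ≈ pick a i ((∑< J) g)
  ∑<-pick-comm J zero    zero    g = refl
  ∑<-pick-comm J zero    (suc i) g = ∑<-zero J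
  ∑<-pick-comm J (suc a) zero    g = ∑<-zero J
  ∑<-pick-comm J (suc a) (suc i) g = ∑<-pick-comm J a i g

  *-pick : ∀ k a i → k * pick a i 1# ≈ pick a i k
  *-pick k zero    zero    = *-identityʳ k
  *-pick k zero    (suc i) = zeroʳ k
  *-pick k (suc a) zero    = zeroʳ k
  *-pick k (suc a) (suc i) = *-pick k a i

  *-indicator : ∀ k i j a b → k * indicator i j (+ a , + b) ≈ pick a i (pick b j k)
  *-indicator k zero    j zero    b = *-pick k b j
  *-indicator k zero    j (suc a) b = zeroʳ k
  *-indicator k (suc i) j zero    b = zeroʳ k
  *-indicator k (suc i) j (suc a) b = *-indicator k i j a b

  box-picks : ∀ x y I J a b →
    box x y I J (+ a , + b) ≈ (∑< I) (λ i → pick a i ((∑< J) (λ j → pick b j (x ^ i * y ^ j))))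
  box-picks x y I J a b = ∑<-cong I λ i → trans
    (∑<-cong J λ j → *-indicator (x ^ i * y ^ j) i j a b)
    (∑<-pick-comm J a i (λ j → pick b j (x ^ i * y ^ j)))

  box-inside : ∀ x y {I J a b} → a ℕ.< I → b ℕ.< J →
    box x y I J (+ a , + b) ≈ monomial x y (+ a , + b)
  box-inside x y {I} {J} {a} {b} a<I b<J = trans (box-picks x y I J a b)
    (trans (∑<-pick-< {a} {I} (λ i → (∑< J) (λ j → pick b j (x ^ i * y ^ j))) a<I)
           (∑<-pick-< {b} {J} (λ j → x ^ a * y ^ j) b<J))

  box-value : ∀ x y I J {p} → InQuadrant p → box x y I J p ≈ monomial x y p ⊎ box x y I J p ≈ 0#
  box-value x y I J {+ a      , + b     } _ = byCases (ℕ.<-≤-connex a I) (ℕ.<-≤-connex b J)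
    where
    byCases : a ℕ.< I ⊎ I ℕ.≤ a → b ℕ.< J ⊎ J ℕ.≤ b →
      box x y I J (+ a , + b) ≈ monomial x y (+ a , + b) ⊎ box x y I J (+ a , + b) ≈ 0#
    byCases (inj₁ a<I) (inj₁ b<J) = inj₁ (box-inside x y a<I b<J)
    byCases (inj₁ a<I) (inj₂ J≤b) = inj₂ (trans (box-picks x y I J a b)
      (trans (∑<-pick-< {a} {I} (λ i → (∑< J) (λ j → pick b j (x ^ i * y ^ j))) a<I)
             (∑<-pick-≥ {b} {J} (λ j → x ^ a * y ^ j) J≤b)))
    byCases (inj₂ I≤a) _ = inj₂ (trans (box-picks x y I J a b)
      (∑<-pick-≥ {a} {I} (λ i → (∑< J) (λ j → pick b j (x ^ i * y ^ j))) I≤a))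
  box-value x y I J { + _      , -[1+ _ ]} (_ , ())
  box-value x y I J { -[1+ _ ] , _       } (() , _)

  infixr 8 _↑_
  _↑_ : Carrier → ℤ → Carrier
  x ↑ i = x ^ ℤ.∣ 1ℤ ℤ.+ i ∣

  stepPolynomial : StepSet → Carrier → Carrier → Carrier
  stepPolynomial L x y = sumList (map (λ (i , j) → x ↑ i * y ↑ j) L)

  -- The part of Q(x,y;z) coming from walks of length `n`, with the weight z^n included and no
  -- cut-off by a box.
  W : ℕ → Carrier → Carrier → Carrier
  W n x y = E n (monomial x y) origin

  W-zero : ∀ x y → W 0 x y ≈ 1#
  W-zero x y = *-identityˡ 1#

  module _ (shape : SingularShape S) where

    -- Each step raises a coordinate by at most one, so a walk of length `n` from the origin ends at
    -- coordinates at most `n` and the cut-off has no effect.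
    E-box : ∀ x y {n I J} → n ℕ.< I → n ℕ.< J → E n (box x y I J) origin ≈ W n x y
    E-box x y {n} {I} {J} n<I n<J = E-local (Inside I J)
      (λ {n} {p} s∈S → inside-⊕ {I} {J} {n} {p} (All.lookup (singular-small shape) s∈S))
      agree n {origin} (ℤ.+<+ n<I , ℤ.+<+ n<J)
      where
      agree : ∀ {p} → InQuadrant p → Inside I J 0 p → box x y I J p ≈ monomial x y p
      agree {+ a      , + b     } _ (ℤ.+<+ a<I , ℤ.+<+ b<J) = box-inside x y
        (≡.subst (ℕ._< I) (ℕ.+-identityʳ a) a<I) (≡.subst (ℕ._< J) (ℕ.+-identityʳ b) b<J)
      agree { + _      , -[1+ _ ]} (_ , ())
      agree { -[1+ _ ] , _       } (() , _)

    positive-step : ∀ {s} x y a b → Positive s →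
      x * y * restrict (monomial x y) ((+ a , + b) ⊕ s)
        ≈ x ↑ proj₁ s * y ↑ proj₂ s * monomial x y (+ a , + b)
    positive-step x y a b north
      rewrite ℕ.+-identityʳ a | ℕ.+-comm b 1 =
      solve 4 (λ x y u v → x :* y :* (u :* (y :* v)) := (x :* con 1ℤ) :* (y :* (y :* con 1ℤ)) :* (u :* v))
        refl x y (x ^ a) (y ^ b)
    positive-step x y a b east
      rewrite ℕ.+-identityʳ b | ℕ.+-comm a 1 =
      solve 4 (λ x y u v → x :* y :* ((x :* u) :* v) := (x :* (x :* con 1ℤ)) :* (y :* con 1ℤ) :* (u :* v))
        refl x y (x ^ a) (y ^ b)
    positive-step x y a b northeast
      rewrite ℕ.+-comm a 1 | ℕ.+-comm b 1 =
      solve 4 (λ x y u v → x :* y :* ((x :* u) :* (y :* v)) := (x :* (x :* con 1ℤ)) :* (y :* (y :* con 1ℤ)) :* (u :* v))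
        refl x y (x ^ a) (y ^ b)

    -- The factor x y clears the negative exponent. Since `0# ^ 0` is `1#`, the factor
    -- `monomial 0# y` is supported on the vertical axis, exactly where the step leaves the
    -- quadrant; its term puts back what the restriction removed.
    northwest-step : ∀ x y a b →
      x * y * restrict (monomial x y) ((+ a , + b) ⊕ northwest) + y ^ 2 * monomial 0# y (+ a , + b)
        ≈ x ↑ -1ℤ * y ↑ 1ℤ * monomial x y (+ a , + b)
    northwest-step x y zero b =
      solve 3 (λ x y v → x :* y :* con 0ℤ :+ (y :* (y :* con 1ℤ)) :* (con 1ℤ :* v)
                 := con 1ℤ :* (y :* (y :* con 1ℤ)) :* (con 1ℤ :* v)) refl x y (y ^ b)
    northwest-step x y (suc a) b
      rewrite ℕ.+-comm b 1 =
      solve 5 (λ x y u v o →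
        x :* y :* (u :* (y :* v)) :+ (y :* (y :* con 1ℤ)) :* ((con 0ℤ :* o) :* v)
          := con 1ℤ :* (y :* (y :* con 1ℤ)) :* ((x :* u) :* v)) refl x y (x ^ a) (y ^ b) (0# ^ a)

    southeast-step : ∀ x y a b →
      x * y * restrict (monomial x y) ((+ a , + b) ⊕ southeast) + x ^ 2 * monomial x 0# (+ a , + b)
        ≈ x ↑ 1ℤ * y ↑ -1ℤ * monomial x y (+ a , + b)
    southeast-step x y a zero =
      solve 3 (λ x y v → x :* y :* con 0ℤ :+ (x :* (x :* con 1ℤ)) :* (v :* con 1ℤ)
                 := (x :* (x :* con 1ℤ)) :* con 1ℤ :* (v :* con 1ℤ)) refl x y (x ^ a)
    southeast-step x y a (suc b)
      rewrite ℕ.+-comm a 1 =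
      solve 5 (λ x y u v o →
        x :* y :* ((x :* u) :* v) :+ (x :* (x :* con 1ℤ)) :* (u :* (con 0ℤ :* o))
          := (x :* (x :* con 1ℤ)) :* con 1ℤ :* (u :* (y :* v))) refl x y (x ^ a) (y ^ b) (0# ^ b)

    positive-steps : ∀ {L} x y a b → All Positive L →
      x * y * sumList (map (λ s → restrict (monomial x y) ((+ a , + b) ⊕ s)) L)
        ≈ stepPolynomial L x y * monomial x y (+ a , + b)
    positive-steps x y a b [] = trans (zeroʳ _) (sym (zeroˡ _))
    positive-steps x y a b (s ∷ L) = trans (distribˡ _ _ _) (trans
      (+-cong (positive-step x y a b s) (positive-steps x y a b L)) (sym (distribʳ _ _ _)))

    -- Only the northwest step can cross the vertical axis and only the southeast step the
    -- horizontal one. No step crosses both, hence one correction for each axis and none for the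
    -- corner.
    lastStep-monomial : ∀ x y {p} → InQuadrant p →
      x * y * lastStep (monomial x y) p + (z * x ^ 2 * monomial x 0# p + z * y ^ 2 * monomial 0# y p)
        ≈ z * stepPolynomial S x y * monomial x y p
    lastStep-monomial x y { + _      , -[1+ _ ]} (_ , ())
    lastStep-monomial x y { -[1+ _ ] , _       } (() , _)
    lastStep-monomial x y {p@(+ a , + b)} _ = begin
      x * y * lastStep m p + (z * x ^ 2 * mx + z * y ^ 2 * my)
        ≈⟨ +-congʳ (*-congˡ (*-congˡ (sumList-singular shape step))) ⟩
      x * y * (z * (step northwest + step southeast + steps)) + (z * x ^ 2 * mx + z * y ^ 2 * my)
        ≈⟨ solve 10 (λ x y z nw se r mx my x² y² →
             x :* y :* (z :* (nw :+ se :+ r)) :+ (z :* x² :* mx :+ z :* y² :* my)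
               := z :* ((x :* y :* nw :+ y² :* my) :+ (x :* y :* se :+ x² :* mx) :+ x :* y :* r))
             refl x y z (step northwest) (step southeast) steps mx my (x ^ 2) (y ^ 2) ⟩
      z * ((x * y * step northwest + y ^ 2 * my) + (x * y * step southeast + x ^ 2 * mx) + x * y * steps)
        ≈⟨ *-congˡ (+-cong (+-cong (northwest-step x y a b) (southeast-step x y a b))
             (positive-steps x y a b (positivePart-positive shape))) ⟩
      z * (x ↑ -1ℤ * y ↑ 1ℤ * m p + x ↑ 1ℤ * y ↑ -1ℤ * m p + rest * m p)
        ≈⟨ solve 5 (λ z u v w m → z :* (u :* m :+ v :* m :+ w :* m) := z :* (u :+ v :+ w) :* m)
             refl z (x ↑ -1ℤ * y ↑ 1ℤ) (x ↑ 1ℤ * y ↑ -1ℤ) rest (m p) ⟩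
      z * (x ↑ -1ℤ * y ↑ 1ℤ + x ↑ 1ℤ * y ↑ -1ℤ + rest) * m p
        ≈⟨ *-congʳ (*-congˡ (sumList-singular shape (λ (i , j) → x ↑ i * y ↑ j))) ⟨
      z * stepPolynomial S x y * m p ∎
      where
      m : Point → Carrier
      m = monomial x y
      mx my rest steps : Carrier
      mx = monomial x 0# p
      my = monomial 0# y p
      rest = stepPolynomial (positivePart shape) x y
      step : Point → Carrier
      step s = restrict m (p ⊕ s)
      steps = sumList (map step (positivePart shape))

    -- The identity for a single last step, summed over all walks of length `n` by linearity of `E`.
    W-suc : ∀ n x y →
      x * y * W (suc n) x y + (z * x ^ 2 * W n x 0# + z * y ^ 2 * W n 0# y)
        ≈ z * stepPolynomial S x y * W n x y
    W-suc n x y = begin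
      x * y * W (suc n) x y + (z * x ^ 2 * W n x 0# + z * y ^ 2 * W n 0# y)
        ≈⟨ +-cong (trans (*-congˡ (E-suc n (monomial x y) origin)) (sym (E-* _ _ n origin)))
                  (+-cong (sym (E-* _ _ n origin)) (sym (E-* _ _ n origin))) ⟩
      E n f origin + (E n g origin + E n h origin)
        ≈⟨ +-congˡ (E-+ g h n origin) ⟨
      E n f origin + E n (λ p → g p + h p) origin
        ≈⟨ E-+ f (λ p → g p + h p) n origin ⟨
      E n (λ p → f p + (g p + h p)) origin
        ≈⟨ E-cong (lastStep-monomial x y) n origin ⟩
      E n (λ p → z * stepPolynomial S x y * monomial x y p) origin
        ≈⟨ E-* _ (monomial x y) n origin ⟩
      z * stepPolynomial S x y * W n x y ∎
      where
      f g h : Point → Carrier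
      f p = x * y * lastStep (monomial x y) p
      g p = z * x ^ 2 * monomial x 0# p
      h p = z * y ^ 2 * monomial 0# y p

    -- On the kernel curve, W-suc telescopes.
    truncated-equation : ∀ x y → z * stepPolynomial S x y ≈ x * y → ∀ M →
      z * x ^ 2 * (∑< M) (λ n → W n x 0#) + z * y ^ 2 * (∑< M) (λ n → W n 0# y)
        + x * y * W M x y ≈ x * y
    truncated-equation x y onCurve zero = trans
      (+-cong (+-cong (zeroʳ _) (zeroʳ _)) (*-congˡ (W-zero x y)))
      (solve 2 (λ x y → (con 0ℤ :+ con 0ℤ) :+ x :* y :* con 1ℤ := x :* y) refl x y)
    truncated-equation x y onCurve (suc M) = begin
      z * x ^ 2 * (∑< suc M) (λ n → W n x 0#) + z * y ^ 2 * (∑< suc M) (λ n → W n 0# y)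
        + x * y * W (suc M) x y
        ≈⟨ +-congʳ (+-cong (*-congˡ (∑<-suc M (λ n → W n x 0#))) (*-congˡ (∑<-suc M (λ n → W n 0# y)))) ⟩
      z * x ^ 2 * (P + W M x 0#) + z * y ^ 2 * (Q + W M 0# y) + x * y * W (suc M) x y
        ≈⟨ solve 7 (λ k l P Q u v w → k :* (P :+ u) :+ l :* (Q :+ v) :+ w
             := k :* P :+ l :* Q :+ (w :+ (k :* u :+ l :* v)))
             refl (z * x ^ 2) (z * y ^ 2) P Q (W M x 0#) (W M 0# y) (x * y * W (suc M) x y) ⟩
      z * x ^ 2 * P + z * y ^ 2 * Q + (x * y * W (suc M) x y + (z * x ^ 2 * W M x 0# + z * y ^ 2 * W M 0# y))
        ≈⟨ +-congˡ (trans (W-suc M x y) (*-congʳ onCurve)) ⟩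
      z * x ^ 2 * P + z * y ^ 2 * Q + x * y * W M x y
        ≈⟨ truncated-equation x y onCurve M ⟩
      x * y ∎
      where
      P Q : Carrier
      P = (∑< M) (λ n → W n x 0#)
      Q = (∑< M) (λ n → W n 0# y)

    -- `monomial 0# 0#` singles out the origin among the points of the quadrant, and no step leads
    -- there from inside the quadrant: every step has a positive coordinate.
    W-origin : ∀ n → W (suc n) 0# 0# ≈ 0#
    W-origin n = trans (E-suc n (monomial 0# 0#) origin) (E-zero vanish n origin)
      where
      vanish-step : ∀ {s} a b → Positive s → restrict (monomial 0# 0#) ((+ a , + b) ⊕ s) ≈ 0#
      vanish-step a b north rewrite ℕ.+-comm b 1 = trans (*-congˡ (zeroˡ _)) (zeroʳ _)
      vanish-step a b east rewrite ℕ.+-comm a 1 = trans (*-congʳ (zeroˡ _)) (zeroˡ _)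
      vanish-step a b northeast rewrite ℕ.+-comm a 1 = trans (*-congʳ (zeroˡ _)) (zeroˡ _)
      vanish-steps : ∀ {L} a b → All Positive L →
        sumList (map (λ s → restrict (monomial 0# 0#) ((+ a , + b) ⊕ s)) L) ≈ 0#
      vanish-steps a b []      = refl
      vanish-steps a b (s ∷ L) = trans (+-cong (vanish-step a b s) (vanish-steps a b L)) (+-identityˡ 0#)
      vanish-nw : ∀ a b → restrict (monomial 0# 0#) ((+ a , + b) ⊕ northwest) ≈ 0#
      vanish-nw zero    b = refl
      vanish-nw (suc a) b rewrite ℕ.+-comm b 1 = trans (*-congˡ (zeroˡ _)) (zeroʳ _)
      vanish-se : ∀ a b → restrict (monomial 0# 0#) ((+ a , + b) ⊕ southeast) ≈ 0#
      vanish-se a zero    = refl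
      vanish-se a (suc b) rewrite ℕ.+-comm a 1 = trans (*-congʳ (zeroˡ _)) (zeroˡ _)
      vanish : ∀ {p} → InQuadrant p → lastStep (monomial 0# 0#) p ≈ 0#
      vanish { + _      , -[1+ _ ]} (_ , ())
      vanish { -[1+ _ ] , _       } (() , _)
      vanish {+ a , + b} _ = trans (*-congˡ (trans (sumList-singular shape (λ s → restrict (monomial 0# 0#) ((+ a , + b) ⊕ s)))
        (trans (+-cong (+-cong (vanish-nw a b) (vanish-se a b)) (vanish-steps a b (positivePart-positive shape)))
          (trans (+-congʳ (+-identityˡ 0#)) (+-identityˡ 0#))))) (zeroʳ z)

-- Exchange symmetry, Vieta's formulas and the contraction bound for the kernel roots.

exchange-positive : ∀ {S} → All Positive S → All Positive (exchange S)
exchange-positive []                = []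
exchange-positive (north     ∷ pos) = east ∷ exchange-positive pos
exchange-positive (east      ∷ pos) = north ∷ exchange-positive pos
exchange-positive (northeast ∷ pos) = northeast ∷ exchange-positive pos

exchange-shape : ∀ {S} → SingularShape S → SingularShape (exchange S)
exchange-shape (nw∷se∷ pos) = se∷nw∷ (exchange-positive pos)
exchange-shape (se∷nw∷ pos) = nw∷se∷ (exchange-positive pos)

positive-rows : ∀ {S} → All Positive S → All (λ s → proj₂ s ∈ (1ℤ ∷ 0ℤ ∷ -1ℤ ∷ [])) S
positive-rows = All.map λ where
  north     → here ≡.refl
  east      → there (here ≡.refl)
  northeast → here ≡.refl

singular-rows : ∀ {S} → SingularShape S → All (λ s → proj₂ s ∈ (1ℤ ∷ 0ℤ ∷ -1ℤ ∷ [])) S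
singular-rows (nw∷se∷ pos) = here ≡.refl ∷ there (there (here ≡.refl)) ∷ positive-rows pos
singular-rows (se∷nw∷ pos) = there (there (here ≡.refl)) ∷ here ≡.refl ∷ positive-rows pos

module QuadraticRoots {c ℓ} (A : CommutativeRing c ℓ) where
  open CommutativeRing A
  open Algebra.Definitions.RawSemiring (Semiring.rawSemiring semiring) using (_^_) renaming (_×_ to _·_)
  open IntegerSolver A
  open Relation.Binary.Reasoning.Setoid setoid

  module _ {a b c √d h y₀ y₁}
    (√d²≈d : √d * √d ≈ b * b - 4 · (a * c)) (h-spec : h * (2 · a) ≈ 1#)
    (y₀-spec : y₀ ≈ (- b + √d) * h) (y₁-spec : y₁ ≈ (- b - √d) * h) where

    a-inverse : a * (h + h) ≈ 1#
    a-inverse = trans (solve 2 (λ a h → a :* (h :+ h) := h :* (a :+ (a :+ con 0ℤ))) refl a h) h-spec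

    root-sum : a * (y₀ + y₁) ≈ - b
    root-sum = begin
      a * (y₀ + y₁)                                ≈⟨ *-congˡ (+-cong y₀-spec y₁-spec) ⟩
      a * ((- b + √d) * h + (- b - √d) * h)        ≈⟨ solve 4 (λ a b s h →
        a :* ((:- b :+ s) :* h :+ (:- b :- s) :* h) := a :* (h :+ h) :* :- b) refl a b √d h ⟩
      a * (h + h) * - b                            ≈⟨ *-congʳ a-inverse ⟩
      1# * - b                                     ≈⟨ *-identityˡ _ ⟩
      - b                                          ∎

    root-product : a * (y₀ * y₁) ≈ c
    root-product = begin
      a * (y₀ * y₁)                                ≈⟨ *-congˡ (*-cong y₀-spec y₁-spec) ⟩
      a * ((- b + √d) * h * ((- b - √d) * h))      ≈⟨ solve 4 (λ a b s h →
        a :* ((:- b :+ s) :* h :* ((:- b :- s) :* h)) := a :* (h :* h) :* (b :* b :- s :* s)) refl a b √d h ⟩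
      a * (h * h) * (b * b - √d * √d)              ≈⟨ *-congˡ (+-congˡ (-‿cong √d²≈d)) ⟩
      a * (h * h) * (b * b - (b * b - 4 · (a * c))) ≈⟨ solve 4 (λ a b c h →
        a :* (h :* h) :* (b :* b :- (b :* b :- (a :* c :+ (a :* c :+ (a :* c :+ (a :* c :+ con 0ℤ))))))
        := a :* (h :+ h) :* (a :* (h :+ h)) :* c) refl a b c h ⟩
      a * (h + h) * (a * (h + h)) * c              ≈⟨ *-congʳ (*-cong a-inverse a-inverse) ⟩
      1# * 1# * c                                  ≈⟨ solve 1 (λ c → con 1ℤ :* con 1ℤ :* c := c) refl c ⟩
      c                                            ∎

    -- Replacing b and c by means of Vieta's formulas leaves a y² - a (y + w) y + a y w, which
    -- vanishes identically.
    y₀-root : a * y₀ ^ 2 + b * y₀ + c ≈ 0#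
    y₀-root = begin
      a * y₀ ^ 2 + b * y₀ + c                      ≈⟨ +-cong (+-congˡ (*-congʳ
        (trans (solve 1 (λ b → b := :- :- b) refl b) (-‿cong (sym root-sum))))) (sym root-product) ⟩
      a * y₀ ^ 2 + - (a * (y₀ + y₁)) * y₀ + a * (y₀ * y₁)  ≈⟨ solve 3 (λ a y w →
        a :* (y :* (y :* con 1ℤ)) :+ :- (a :* (y :+ w)) :* y :+ a :* (y :* w) := con 0ℤ) refl a y₀ y₁ ⟩
      0#                                           ∎

  -- This factor x of b, together with c = z x², makes the bound on the smaller root proportional to
  -- |x| without a division by x.
  b-factor : ∀ {z x row r₀} → row ≈ x * r₀ → - x + z * row ≈ x * (z * r₀ - 1#)
  b-factor {z} {x} {row} {r₀} row≈ = trans (+-congˡ (*-congˡ row≈))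
    (solve 3 (λ z x r → :- x :+ z :* (x :* r) := x :* (z :* r :- con 1ℤ)) refl z x r₀)

  x-y≈0⇒x≈y : ∀ {x y} → x - y ≈ 0# → x ≈ y
  x-y≈0⇒x≈y {x} {y} eq = trans (solve 2 (λ x y → x := (x :- y) :+ y) refl x y)
    (trans (+-congʳ eq) (+-identityˡ y))

module RootBounds {ℓ ℓ₁ ℓ₂ ℓ₃} (R : Reals ℓ ℓ₁ ℓ₂ ℓ₃) where
  open Walks R
  open ComplexBounds R
  open ℝ using (_≤_; _:=_; _:+_; _:*_; _:-_; :-_; con)
  open QuadraticRoots commutativeRing

  -- `ups` and `levels` count the steps with second coordinate 1 and 0. In a singular set exactly
  -- one further step has second coordinate -1, so these counts split θ into the weights of the
  -- three rows. `r₀` is the quotient of row 0 by x.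
  record RowBounds (S : StepSet) (x : ℂ) : Set (ℓ ⊔ ℓ₁ ⊔ ℓ₃) where
    field
      ups levels : ℕ
      r₀         : ℂ
      row₁≲      : row S 1ℤ x ≲ ups ℝ.· ℝ.1#
      row₀≈      : row S 0ℤ x ≈ x * r₀
      r₀≲        : r₀ ≲ levels ℝ.· ℝ.1#

  record PositiveRows (S : StepSet) (x : ℂ) : Set (ℓ ⊔ ℓ₁ ⊔ ℓ₃) where
    field
      rowBounds : RowBounds S x
    open RowBounds rowBounds public
    field
      row₋₁≈0 : row S -1ℤ x ≈ 0#
      count   : ups ℕ.+ levels ≡ length S

  positiveRows : ∀ {S} x → x ≲ ℝ.1# → All Positive S → PositiveRows S x
  positiveRows x x≲1 [] = record
    { rowBounds = record
      { ups = 0 ; levels = 0 ; r₀ = 0# ; row₁≲ = 0≲ ℝ.≤-refl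
      ; row₀≈ = sym (zeroʳ x) ; r₀≲ = 0≲ ℝ.≤-refl }
    ; row₋₁≈0 = refl ; count = ≡.refl }
  positiveRows x x≲1 (north ∷ pos) = record
    { rowBounds = record
      { ups = suc ups ; levels = levels ; r₀ = r₀ ; row₁≲ = ≲-+ (≲1-^ 1 x≲1) row₁≲
      ; row₀≈ = row₀≈ ; r₀≲ = r₀≲ }
    ; row₋₁≈0 = row₋₁≈0 ; count = ≡.cong suc count }
    where open PositiveRows (positiveRows x x≲1 pos)
  positiveRows x x≲1 (northeast ∷ pos) = record
    { rowBounds = record
      { ups = suc ups ; levels = levels ; r₀ = r₀ ; row₁≲ = ≲-+ (≲1-^ 2 x≲1) row₁≲
      ; row₀≈ = row₀≈ ; r₀≲ = r₀≲ }
    ; row₋₁≈0 = row₋₁≈0 ; count = ≡.cong suc count }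
    where open PositiveRows (positiveRows x x≲1 pos)
  positiveRows x x≲1 (east ∷ pos) = record
    { rowBounds = record
      { ups = ups ; levels = suc levels ; r₀ = x ^ 1 + r₀ ; row₁≲ = row₁≲
      ; row₀≈ = trans (+-congˡ row₀≈) (sym (distribˡ x _ _)) ; r₀≲ = ≲-+ (≲1-^ 1 x≲1) r₀≲ }
    ; row₋₁≈0 = row₋₁≈0 ; count = ≡.trans (ℕ.+-suc ups levels) (≡.cong suc count) }
    where open PositiveRows (positiveRows x x≲1 pos)

  record SingularRows (S : StepSet) (x : ℂ) : Set (ℓ ⊔ ℓ₁ ⊔ ℓ₃) where
    field
      rowBounds : RowBounds S x
    open RowBounds rowBounds public
    field
      row₋₁≈x² : row S -1ℤ x ≈ x ^ 2
      count    : ups ℕ.+ levels ℕ.+ 1 ≡ length S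

  singularRows : ∀ {S} x → x ≲ ℝ.1# → SingularShape S → SingularRows S x
  singularRows x x≲1 (nw∷se∷ pos) = record
    { rowBounds = record
      { ups = suc ups ; levels = levels ; r₀ = r₀ ; row₁≲ = ≲-+ 1≲1 row₁≲
      ; row₀≈ = row₀≈ ; r₀≲ = r₀≲ }
    ; row₋₁≈x² = trans (+-congˡ row₋₁≈0) (+-identityʳ _)
    ; count = ≡.cong suc (≡.trans (ℕ.+-comm _ 1) (≡.cong suc count)) }
    where open PositiveRows (positiveRows x x≲1 pos)
  singularRows x x≲1 (se∷nw∷ pos) = record
    { rowBounds = record
      { ups = suc ups ; levels = levels ; r₀ = r₀ ; row₁≲ = ≲-+ 1≲1 row₁≲
      ; row₀≈ = row₀≈ ; r₀≲ = r₀≲ }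
    ; row₋₁≈x² = trans (+-congˡ row₋₁≈0) (+-identityʳ _)
    ; count = ≡.cong suc (≡.trans (ℕ.+-comm _ 1) (≡.cong suc count)) }
    where open PositiveRows (positiveRows x x≲1 pos)

  re-≤ : ∀ {w r} → w ≲ r → re w ≤ r
  re-≤ {w} (bound 0≤r w≤r) =
    ℝ.x²-cancel-≤ 0≤r (ℝ.≤-trans (ℝ.0≤d⇒x≤x+d (ℝ.x²-nonneg (im w)) ℝ.refl) w≤r)

  -- The reverse triangle inequality by way of real parts: |1 - w| is at least 1 - Re w, hence at
  -- least 1 - r.
  [1-r]²≤∣1-w∣² : ∀ {w r} → w ≲ r → r ≤ ℝ.1# → (ℝ.1# ℝ.- r) ℝ.* (ℝ.1# ℝ.- r) ≤ ∣ w - 1# ∣²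
  [1-r]²≤∣1-w∣² {w} {r} w≲r r≤1 = begin
    (ℝ.1# ℝ.- r) ℝ.* (ℝ.1# ℝ.- r)        ≤⟨ ℝ.*-mono-≤ 0≤1-r 1-r≤1-re 0≤1-r 1-r≤1-re ⟩
    (ℝ.1# ℝ.- re w) ℝ.* (ℝ.1# ℝ.- re w)  ≤⟨ ℝ.0≤d⇒x≤x+d (ℝ.x²-nonneg (im w)) (ℝ.solve 2 (λ a b →
      (a :- con 1ℤ) :* (a :- con 1ℤ) :+ (b :- con 0ℤ) :* (b :- con 0ℤ)
        := (con 1ℤ :- a) :* (con 1ℤ :- a) :+ b :* b) ℝ.refl (re w) (im w)) ⟩
    ∣ w - 1# ∣²                          ∎
    where
    open ℝ.≤-Reasoning
    0≤1-r : ℝ.0# ≤ ℝ.1# ℝ.- r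
    0≤1-r = ℝ.x≤y⇒0≤y-x r≤1
    1-r≤1-re : ℝ.1# ℝ.- r ≤ ℝ.1# ℝ.- re w
    1-r≤1-re = ℝ.0≤d⇒x≤x+d (ℝ.x≤y⇒0≤y-x (re-≤ w≲r))
      (ℝ.solve 2 (λ a r → con 1ℤ :- a := (con 1ℤ :- r) :+ (r :- a)) ℝ.refl (re w) r)

  -- Both roots cannot exceed θ|x| in modulus: otherwise (|y₀|-θ|x|)(|y₁|-θ|x|) > 0
  -- contradicts Vieta's formulas, because the middle coefficient dominates on |y| = θ|x|.
  vieta-bound : ∀ {a x y₀ y₁ : ℂ} {α β ζ θ : ℝ.Carrier} →
    ℝ.0# ℝ.< ∣ a ∣² → a ≲ α → ℝ.0# ≤ ζ → ℝ.0# ≤ θ →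
    ∣ a * (y₀ * y₁) ∣² ℝ.≈ (ζ ℝ.* ∣ x ∣²) ℝ.* (ζ ℝ.* ∣ x ∣²) →
    (ℝ.1# ℝ.- β) ℝ.* (ℝ.1# ℝ.- β) ℝ.* ∣ x ∣² ≤ ∣ a * (y₀ + y₁) ∣² →
    ζ ℝ.+ α ℝ.* (θ ℝ.* θ) ≤ θ ℝ.* (ℝ.1# ℝ.- β) →
    ∣ y₀ ∣≤∣ y₁ ∣ → ∣ y₀ ∣² ≤ (θ ℝ.* θ) ℝ.* ∣ x ∣²
  vieta-bound {a} {x} {y₀@(p +i q)} {y₁@(u +i v)} {α} {β} {ζ} {θ}
    0<A (bound 0≤α A≤α²) 0≤ζ 0≤θ product sum dominates y₀≤y₁ τ<n₀ = ℝ.<-irrefl ℝ.refl (begin-strict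
    τ ℝ.* B
      ≈⟨ ℝ.*-congˡ (ℝ.trans (∣∣²-* a (y₀ + y₁)) (ℝ.solve 5 (λ A p q u v →
           A :* ((p :+ u) :* (p :+ u) :+ (q :+ v) :* (q :+ v)) :=
           A :* ((p :* p :+ q :* q) :+ (u :* u :+ v :* v) :+ ((p :* u :+ q :* v) :+ (p :* u :+ q :* v))))
           ℝ.refl A p q u v)) ⟩
    τ ℝ.* (A ℝ.* (n₀ ℝ.+ n₁ ℝ.+ (d ℝ.+ d)))
      -- The product (n₀ - τ)(n₁ - τ) of squared quantities is positive because both roots are
      -- assumed larger than θ|x|. Its expansion is completed by the inner product `d` so that |y₀ +
      -- y₁|² appears.
      <⟨ ℝ.0<d⇒x<x+d (ℝ.*-pos 0<A (ℝ.*-pos (ℝ.x<y⇒0<y-x τ<n₀) (ℝ.x<y⇒0<y-x τ<n₁)))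
           (ℝ.solve 5 (λ A n₀ n₁ d τ →
             A :* (n₀ :* n₁) :+ A :* (τ :* τ) :+ τ :* (A :* d :+ A :* d) :=
             τ :* (A :* (n₀ :+ n₁ :+ (d :+ d))) :+ A :* ((n₀ :- τ) :* (n₁ :- τ)))
             ℝ.refl A n₀ n₁ d τ) ⟩
    A ℝ.* (n₀ ℝ.* n₁) ℝ.+ A ℝ.* (τ ℝ.* τ) ℝ.+ τ ℝ.* (A ℝ.* d ℝ.+ A ℝ.* d)
      ≤⟨ ℝ.+-mono-≤ (ℝ.+-mono-≤ (ℝ.≤-reflexive An₀n₁≈[ζX]²)
           (ℝ.*-mono-≤ (ℝ.<⇒≤ 0<A) A≤α² (ℝ.x²-nonneg τ) ℝ.≤-refl))
           (ℝ.*-monoˡ-≤ 0≤τ (ℝ.+-mono-≤ Ad≤αζX Ad≤αζX)) ⟩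
    (ζ ℝ.* X) ℝ.* (ζ ℝ.* X) ℝ.+ (α ℝ.* α) ℝ.* (τ ℝ.* τ) ℝ.+ τ ℝ.* (α ℝ.* (ζ ℝ.* X) ℝ.+ α ℝ.* (ζ ℝ.* X))
      -- The three upper bounds add up to a perfect square, to which the hypothesis `dominates` can
      -- be applied.
      ≈⟨ ℝ.solve 4 (λ ζ α X t → (ζ :* X) :* (ζ :* X) :+ (α :* α) :* ((t :* t :* X) :* (t :* t :* X))
           :+ (t :* t :* X) :* (α :* (ζ :* X) :+ α :* (ζ :* X)) :=
           (X :* (ζ :+ α :* (t :* t))) :* (X :* (ζ :+ α :* (t :* t)))) ℝ.refl ζ α X θ ⟩
    (X ℝ.* (ζ ℝ.+ α ℝ.* (θ ℝ.* θ))) ℝ.* (X ℝ.* (ζ ℝ.+ α ℝ.* (θ ℝ.* θ)))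
      ≤⟨ ℝ.*-mono-≤ 0≤lower lower≤ 0≤lower lower≤ ⟩
    (X ℝ.* (θ ℝ.* (ℝ.1# ℝ.- β))) ℝ.* (X ℝ.* (θ ℝ.* (ℝ.1# ℝ.- β)))
      ≈⟨ ℝ.solve 3 (λ X t b → (X :* (t :* (con 1ℤ :- b))) :* (X :* (t :* (con 1ℤ :- b))) :=
           t :* t :* X :* ((con 1ℤ :- b) :* (con 1ℤ :- b) :* X)) ℝ.refl X θ β ⟩
    τ ℝ.* ((ℝ.1# ℝ.- β) ℝ.* (ℝ.1# ℝ.- β) ℝ.* X)
      ≤⟨ ℝ.*-monoˡ-≤ 0≤τ sum ⟩
    τ ℝ.* B ∎)
    where
    open ℝ.≤-Reasoning
    A B X n₀ n₁ d τ : ℝ.Carrier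
    A = ∣ a ∣²
    B = ∣ a * (y₀ + y₁) ∣²
    X = ∣ x ∣²
    n₀ = ∣ y₀ ∣²
    n₁ = ∣ y₁ ∣²
    d = p ℝ.* u ℝ.+ q ℝ.* v
    τ = θ ℝ.* θ ℝ.* X
    0≤X : ℝ.0# ≤ X
    0≤X = ∣∣²-nonneg x
    0≤ζX : ℝ.0# ≤ ζ ℝ.* X
    0≤ζX = ℝ.*-nonneg 0≤ζ 0≤X
    0≤τ : ℝ.0# ≤ τ
    0≤τ = ℝ.*-nonneg (ℝ.x²-nonneg θ) 0≤X
    τ<n₁ : τ ℝ.< n₁
    τ<n₁ = ℝ.<-≤-trans τ<n₀ y₀≤y₁
    0≤lower : ℝ.0# ≤ X ℝ.* (ζ ℝ.+ α ℝ.* (θ ℝ.* θ))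
    0≤lower = ℝ.*-nonneg 0≤X (ℝ.+-nonneg 0≤ζ (ℝ.*-nonneg 0≤α (ℝ.x²-nonneg θ)))
    lower≤ : X ℝ.* (ζ ℝ.+ α ℝ.* (θ ℝ.* θ)) ≤ X ℝ.* (θ ℝ.* (ℝ.1# ℝ.- β))
    lower≤ = ℝ.*-monoˡ-≤ 0≤X dominates
    An₀n₁≈[ζX]² : A ℝ.* (n₀ ℝ.* n₁) ℝ.≈ (ζ ℝ.* X) ℝ.* (ζ ℝ.* X)
    An₀n₁≈[ζX]² = ℝ.trans (ℝ.*-congˡ (ℝ.sym (∣∣²-* y₀ y₁))) (ℝ.trans (ℝ.sym (∣∣²-* a (y₀ * y₁))) product)
    Ad≤αζX : A ℝ.* d ≤ α ℝ.* (ζ ℝ.* X)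
    -- Cauchy-Schwarz bounds d² by n₀ n₁, the product of the roots evaluates A n₀ n₁, and the
    -- remaining factor A is at most α².
    Ad≤αζX = ℝ.x²-cancel-≤ (ℝ.*-nonneg 0≤α 0≤ζX) (begin
      (A ℝ.* d) ℝ.* (A ℝ.* d)
        ≤⟨ ℝ.0≤d⇒x≤x+d (ℝ.x²-nonneg (A ℝ.* (p ℝ.* v ℝ.- q ℝ.* u))) (ℝ.solve 5 (λ A p q u v →
             A :* (A :* ((p :* p :+ q :* q) :* (u :* u :+ v :* v))) :=
             (A :* (p :* u :+ q :* v)) :* (A :* (p :* u :+ q :* v))
               :+ (A :* (p :* v :- q :* u)) :* (A :* (p :* v :- q :* u))) ℝ.refl A p q u v) ⟩
      A ℝ.* (A ℝ.* (n₀ ℝ.* n₁))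
        ≈⟨ ℝ.*-congˡ An₀n₁≈[ζX]² ⟩
      A ℝ.* ((ζ ℝ.* X) ℝ.* (ζ ℝ.* X))
        ≤⟨ ℝ.*-mono-≤ (ℝ.<⇒≤ 0<A) A≤α² (ℝ.x²-nonneg (ζ ℝ.* X)) ℝ.≤-refl ⟩
      (α ℝ.* α) ℝ.* ((ζ ℝ.* X) ℝ.* (ζ ℝ.* X))
        ≈⟨ ℝ.solve 2 (λ a b → (a :* a) :* (b :* b) := (a :* b) :* (a :* b)) ℝ.refl α (ζ ℝ.* X) ⟩
      (α ℝ.* (ζ ℝ.* X)) ℝ.* (α ℝ.* (ζ ℝ.* X)) ∎)

  module _ {S : StepSet} (shape : SingularShape S) {ζ : ℝ.Carrier} (0<ζ : ℝ.0# ℝ.< ζ)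
    (kζ<1 : length S ℝ.· ζ ℝ.< ℝ.1#) {x y₀ : ℂ} (x≲1 : x ≲ ℝ.1#) (root : SmallerRoot S (fromℝ ζ) x y₀) where

    private
      z = fromℝ ζ
      θ = length S ℝ.· ζ
    open SmallerRoot root
    open SingularRows (singularRows x x≲1 shape)

    smallerRoot-onKernel : z * sumList (map (λ (i , j) → x ↑ i * y₀ ↑ j) S) ≈ x * y₀
    smallerRoot-onKernel = x-y≈0⇒x≈y (trans (kernel-quadratic S (singular-rows shape) z x y₀)
      (y₀-root √d*√d≈d 1/2a-spec y₀-spec y₁-spec))

    smallerRoot-bound : ∣ y₀ ∣² ≤ (θ ℝ.* θ) ℝ.* ∣ x ∣²
    smallerRoot-bound = vieta-bound {a S z x} {x} {y₀} {y₁} {α} {β} {ζ} {θ}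
      0<∣a∣² a≲α (ℝ.<⇒≤ 0<ζ) 0≤θ root-product≈ root-sum≥ dominates ∣y₀∣≤∣y₁∣
      where
      open ℝ.≤-Reasoning
      α β : ℝ.Carrier
      α = ups ℝ.· ζ
      β = levels ℝ.· ζ
      0≤ζ : ℝ.0# ≤ ζ
      0≤ζ = ℝ.<⇒≤ 0<ζ
      0≤α : ℝ.0# ≤ α
      0≤α = ℝ.·-nonneg ups 0≤ζ
      0≤β : ℝ.0# ≤ β
      0≤β = ℝ.·-nonneg levels 0≤ζ
      θ≈α+β+ζ : θ ℝ.≈ α ℝ.+ β ℝ.+ ζ
      θ≈α+β+ζ = ℝ.trans (ℝ.reflexive (≡.cong (ℝ._· ζ) (≡.sym count))) (ℝ.trans
        (ℝ.×-homo-+ ζ (ups ℕ.+ levels) 1) (ℝ.+-cong (ℝ.×-homo-+ ζ ups levels) (ℝ.+-identityʳ ζ)))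
      0≤θ : ℝ.0# ≤ θ
      0≤θ = ℝ.·-nonneg (length S) 0≤ζ
      scale : ∀ n {w} → w ≲ n ℝ.· ℝ.1# → z * w ≲ n ℝ.· ζ
      scale n w≲n = ≲-mono (ℝ.≤-reflexive (ℝ.trans (ℝ.×-comm-* n ζ ℝ.1#) (ℝ.×-congʳ n (ℝ.*-identityʳ ζ))))
        (≲-* (≲-fromℝ 0≤ζ) w≲n)
      a≲α : a S z x ≲ α
      a≲α = scale ups row₁≲
      0<∣a∣² : ℝ.0# ℝ.< ∣ a S z x ∣²
      0<∣a∣² = [ (λ a<0 → ⊥-elim (∣∣²-nonneg (a S z x) a<0)) , id ]′ (ℝ.#⇒<⊎> (ℝ.x*y≈1⇒x#0
        {∣ a S z x ∣²} {∣ 1/2a + 1/2a ∣²}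
        (ℝ.trans (ℝ.sym (∣∣²-* (a S z x) (1/2a + 1/2a))) (ℝ.trans
          (∣∣²-cong {a S z x * (1/2a + 1/2a)} {1#}
            (a-inverse √d*√d≈d 1/2a-spec y₀-spec y₁-spec))
          (ℝ.solve 0 (con 1ℤ :* con 1ℤ :+ con 0ℤ :* con 0ℤ := con 1ℤ) ℝ.refl)))))
      ∣z∣² : ∣ z ∣² ℝ.≈ ζ ℝ.* ζ
      ∣z∣² = ℝ.solve 1 (λ ζ → ζ :* ζ :+ con 0ℤ :* con 0ℤ := ζ :* ζ) ℝ.refl ζ
      root-product≈ : ∣ a S z x * (y₀ * y₁) ∣² ℝ.≈ (ζ ℝ.* ∣ x ∣²) ℝ.* (ζ ℝ.* ∣ x ∣²)
      root-product≈ = ℝ.trans (∣∣²-cong {a S z x * (y₀ * y₁)} {z * (x * x)} (trans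
          (root-product √d*√d≈d 1/2a-spec y₀-spec y₁-spec)
          (*-congˡ (trans row₋₁≈x² (*-congˡ (*-identityʳ x))))))
        (ℝ.trans (∣∣²-* z (x * x)) (ℝ.trans (ℝ.*-cong ∣z∣² (∣∣²-* x x))
          (ℝ.solve 2 (λ ζ X → (ζ :* ζ) :* (X :* X) := (ζ :* X) :* (ζ :* X)) ℝ.refl ζ (∣ x ∣²))))
      -b≈ : - b S z x ≈ - (x * (z * r₀ - 1#))
      -b≈ = -‿cong (b-factor row₀≈)
      root-sum≥ : (ℝ.1# ℝ.- β) ℝ.* (ℝ.1# ℝ.- β) ℝ.* ∣ x ∣² ≤ ∣ a S z x * (y₀ + y₁) ∣²
      root-sum≥ = begin
        (ℝ.1# ℝ.- β) ℝ.* (ℝ.1# ℝ.- β) ℝ.* ∣ x ∣²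
          ≤⟨ ℝ.*-mono-≤ (ℝ.x²-nonneg (ℝ.1# ℝ.- β)) ([1-r]²≤∣1-w∣² (scale levels r₀≲) β≤1)
               (∣∣²-nonneg x) ℝ.≤-refl ⟩
        ∣ z * r₀ - 1# ∣² ℝ.* ∣ x ∣²
          ≈⟨ ℝ.*-comm (∣ z * r₀ - 1# ∣²) (∣ x ∣²) ⟩
        ∣ x ∣² ℝ.* ∣ z * r₀ - 1# ∣²
          ≈⟨ ∣∣²-* x (z * r₀ - 1#) ⟨
        ∣ x * (z * r₀ - 1#) ∣²
          ≈⟨ ∣∣²-neg (x * (z * r₀ - 1#)) ⟨
        ∣ - (x * (z * r₀ - 1#)) ∣²
          ≈⟨ ∣∣²-cong {a S z x * (y₀ + y₁)} { - (x * (z * r₀ - 1#))}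
               (trans (root-sum √d*√d≈d 1/2a-spec y₀-spec y₁-spec) -b≈) ⟨
        ∣ a S z x * (y₀ + y₁) ∣² ∎
        where
        β≤1 : β ≤ ℝ.1#
        β≤1 = ℝ.≤-trans (ℝ.0≤d⇒x≤x+d (ℝ.+-nonneg 0≤α 0≤ζ)
          (ℝ.trans θ≈α+β+ζ (ℝ.solve 3 (λ α β ζ → α :+ β :+ ζ := β :+ (α :+ ζ)) ℝ.refl α β ζ))) (ℝ.<⇒≤ kζ<1)
      -- The reason for the choice θ = kζ. With θ = α + β + ζ, the right side exceeds the left by α
      -- (1 - θ²) + β (1 - θ), which is nonnegative for θ < 1.
      dominates : ζ ℝ.+ α ℝ.* (θ ℝ.* θ) ≤ θ ℝ.* (ℝ.1# ℝ.- β)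
      dominates = ℝ.0≤d⇒x≤x+d
        (ℝ.+-nonneg (ℝ.*-nonneg 0≤α (ℝ.*-nonneg 0≤1-θ (ℝ.+-nonneg ℝ.0≤1 0≤θ))) (ℝ.*-nonneg 0≤β 0≤1-θ))
        (ℝ.trans (ℝ.solve 2 (λ t β → t :* (con 1ℤ :- β) := t :- t :* β) ℝ.refl θ β)
          (ℝ.trans (ℝ.+-congʳ θ≈α+β+ζ) (ℝ.solve 4 (λ t α β ζ →
            α :+ β :+ ζ :- t :* β := (ζ :+ α :* (t :* t)) :+
            (α :* ((con 1ℤ :- t) :* (con 1ℤ :+ t)) :+ β :* (con 1ℤ :- t))) ℝ.refl θ α β ζ)))
        where
        0≤1-θ : ℝ.0# ≤ ℝ.1# ℝ.- θ
        0≤1-θ = ℝ.x≤y⇒0≤y-x (ℝ.<⇒≤ kζ<1)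

singular⇒shape : ∀ {S} → Singular S → SingularShape S
singular⇒shape (T , T∈ , S≡) = fromTable T∈ S≡
  where
  table : ∀ {T} → T ∈ singularSets → SingularShape T
  table (here ≡.refl)                                 = nw∷se∷ (northeast ∷ [])
  table (there (here ≡.refl))                         = nw∷se∷ (north ∷ [])
  table (there (there (here ≡.refl)))                 = nw∷se∷ (north ∷ northeast ∷ [])
  table (there (there (there (here ≡.refl))))         = nw∷se∷ (north ∷ east ∷ [])
  table (there (there (there (there (here ≡.refl))))) = nw∷se∷ (north ∷ northeast ∷ east ∷ [])
  fromTable : ∀ {S T} → T ∈ singularSets → S ≡ T ⊎ S ≡ exchange T → SingularShape S
  fromTable T∈ (inj₁ ≡.refl) = table T∈
  fromTable T∈ (inj₂ ≡.refl) = exchange-shape (table T∈)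

-- Telescoping along the iterates of the two root functions.

module IterationIdentities {c ℓ} (A : CommutativeRing c ℓ) where
  open CommutativeRing A
  open IntegerSolver A
  open FiniteSums A
  open Relation.Binary.Reasoning.Setoid setoid

  sumList-exchange : ∀ (g : Point → Carrier) S → sumList (map g (exchange S)) ≈ sumList (map (g ∘ swap) S)
  sumList-exchange g []      = refl
  sumList-exchange g (s ∷ S) = +-congˡ (sumList-exchange g S)

  x+y-x≈y : ∀ x y → (x + y) - x ≈ y
  x+y-x≈y = solve 2 (λ x y → (x :+ y) :- x := y) refl

  -- Both kernel equations at height y contain the same unknown k, which cancels.
  step-error : ∀ {v x x′ y h h′ k e e′} → h + k + e ≈ x * y → h′ + k + e′ ≈ x′ * y →
    ((v + y * (x - x′)) + h′) - (v + h) ≈ e - e′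
  step-error {v} {x} {x′} {y} {h} {h′} {k} {e} {e′} eq eq′ = begin
    ((v + y * (x - x′)) + h′) - (v + h)
      ≈⟨ solve 6 (λ v x x′ y h h′ → ((v :+ y :* (x :- x′)) :+ h′) :- (v :+ h)
           := (x :* y :- x′ :* y) :+ (h′ :- h)) refl v x x′ y h h′ ⟩
    (x * y - x′ * y) + (h′ - h)
      ≈⟨ +-congʳ (+-cong (sym eq) (-‿cong (sym eq′))) ⟩
    ((h + k + e) - (h′ + k + e′)) + (h′ - h)
      ≈⟨ solve 5 (λ h h′ k e e′ → ((h :+ k :+ e) :- (h′ :+ k :+ e′)) :+ (h′ :- h) := e :- e′)
           refl h h′ k e e′ ⟩
    e - e′ ∎

  -- Splits h - s into three quantities with separate bounds: the accumulated equation errors, the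
  -- boundary term `h′` at the last iterate, and the tail of the series. The `0#` is the empty
  -- partial sum.
  limit-split : ∀ v h h′ s → - ((v + h′) - (0# + h)) + h′ + (v - s) ≈ h - s
  limit-split = solve 4 (λ v h h′ s → :- ((v :+ h′) :- (con 0ℤ :+ h)) :+ h′ :+ (v :- s) := h :- s) refl

  exchange-halves : ∀ {h k e x y} → h + k + e ≈ x * y → k + h + e ≈ y * x
  exchange-halves {h} {k} {e} {x} {y} eq = trans (+-congʳ (+-comm k h)) (trans eq (*-comm x y))

  rescale : ∀ {r d} → r * d ≈ 1# → ∀ B Q s → (B - Q) + r * (d * Q - s) ≈ B - r * s
  rescale {r} {d} rd≈1 B Q s = begin
    (B - Q) + r * (d * Q - s)
      ≈⟨ solve 5 (λ r d B Q s → (B :- Q) :+ r :* (d :* Q :- s) := (B :- Q) :+ ((r :* d) :* Q :- r :* s))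
           refl r d B Q s ⟩
    (B - Q) + (r * d * Q - r * s)
      ≈⟨ +-congˡ (+-congʳ (trans (*-congʳ rd≈1) (*-identityˡ Q))) ⟩
    (B - Q) + (Q - r * s)
      ≈⟨ solve 3 (λ B Q t → (B :- Q) :+ (Q :- t) := B :- t) refl B Q (r * s) ⟩
    B - r * s ∎

  *-inverse : ∀ {r z u x} → r * z ≈ 1# → u * x ≈ 1# → (r * (u * u)) * (z * (x * (x * 1#))) ≈ 1#
  *-inverse {r} {z} {u} {x} rz≈1 ux≈1 = begin
    (r * (u * u)) * (z * (x * (x * 1#)))
      ≈⟨ solve 4 (λ r z u x → (r :* (u :* u)) :* (z :* (x :* (x :* con 1ℤ))) := r :* z :* ((u :* x) :* (u :* x)))
           refl r z u x ⟩
    r * z * ((u * x) * (u * x))  ≈⟨ *-cong rz≈1 (*-cong ux≈1 ux≈1) ⟩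
    1# * (1# * 1#)               ≈⟨ trans (*-identityˡ _) (*-identityˡ _) ⟩
    1#                           ∎

module Iteration {ℓ ℓ₁ ℓ₂ ℓ₃} (R : Reals ℓ ℓ₁ ℓ₂ ℓ₃)
  (θ : Reals.Carrier R) (0<θ : Reals._<_ R (Reals.0# R) θ) (θ<1 : Reals._<_ R θ (Reals.1# R)) where
  open Walks R hiding (∑<_; sumList)
  open ComplexBounds R
  open ℝ using (_≤_; _:=_; _:+_; _:*_; _:-_; :-_; con)
  open Geometric θ 0<θ θ<1
  open FiniteSums commutativeRing using (∑<_; ∑<-suc)
  open IterationIdentities commutativeRing
  open RingIdentities commutativeRing

  Contracting : (ℂ → ℂ) → Set (ℓ ⊔ ℓ₃)
  Contracting F = ∀ w → ∣ w ∣< ℝ.1# → ∣ F w ∣² ≤ (θ ℝ.* θ) ℝ.* ∣ w ∣²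

  contracting-< : ∀ {F} → Contracting F → ∀ {w} → ∣ w ∣< ℝ.1# → ∣ F w ∣< ℝ.1#
  contracting-< {F} F≤ {w} ∣w∣<1@(0<1 , N<1) = 0<1 , (begin-strict
    ∣ F w ∣²                       ≤⟨ F≤ w ∣w∣<1 ⟩
    (θ ℝ.* θ) ℝ.* ∣ w ∣²           ≤⟨ ℝ.*-mono-≤ (ℝ.x²-nonneg θ)
      (ℝ.*-mono-≤ 0≤θ θ≤1 0≤θ θ≤1) (∣∣²-nonneg w) ℝ.≤-refl ⟩
    (ℝ.1# ℝ.* ℝ.1#) ℝ.* ∣ w ∣²     ≈⟨ ℝ.solve 1 (λ N → con 1ℤ :* con 1ℤ :* N := N) ℝ.refl (∣ w ∣²) ⟩
    ∣ w ∣²                         <⟨ N<1 ⟩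
    ℝ.1# ℝ.* ℝ.1#                  ∎)
    where open ℝ.≤-Reasoning

  contracting-≲ : ∀ {F} → Contracting F → ∀ {w r} → ∣ w ∣< ℝ.1# → w ≲ r → F w ≲ θ ℝ.* r
  contracting-≲ {F} F≤ {w} {r} ∣w∣<1 (bound 0≤r w≤r) = bound (ℝ.*-nonneg 0≤θ 0≤r) (begin
    ∣ F w ∣²                       ≤⟨ F≤ w ∣w∣<1 ⟩
    (θ ℝ.* θ) ℝ.* ∣ w ∣²           ≤⟨ ℝ.*-monoˡ-≤ (ℝ.x²-nonneg θ) w≤r ⟩
    (θ ℝ.* θ) ℝ.* (r ℝ.* r)        ≈⟨ ℝ.solve 2 (λ t r → (t :* t) :* (r :* r) := (t :* r) :* (t :* r)) ℝ.refl θ r ⟩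
    (θ ℝ.* r) ℝ.* (θ ℝ.* r)        ∎)
    where open ℝ.≤-Reasoning

  θr≤r : ∀ {r} → ℝ.0# ≤ r → θ ℝ.* r ≤ r
  θr≤r 0≤r = ℝ.≤-trans (ℝ.*-mono-≤ 0≤θ θ≤1 0≤r ℝ.≤-refl) (ℝ.≤-reflexive (ℝ.*-identityˡ _))

  -- H M and K M are the two boundary terms of the functional equation
  -- truncated at length M, and e M is the truncation error.
  module Series (F G : ℂ → ℂ) (F≤ : Contracting F) (G≤ : Contracting G)
    (H K : ℕ → ℂ → ℂ) (e : ℕ → ℂ → ℂ → ℂ)
    (F-equation : ∀ M x → ∣ x ∣< ℝ.1# → H M x + K M (F x) + e M x (F x) ≈ x * F x)
    (G-equation : ∀ M y → ∣ y ∣< ℝ.1# → H M (G y) + K M y + e M (G y) y ≈ G y * y)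
    (e-bound : ∀ M {x y r} → x ≲ ℝ.1# → y ≲ ℝ.1# → x ≲ r → e M x y ≲ r ℝ.* θ ℝ.^ M)
    (C : ℝ.Carrier) (0≤C : ℝ.0# ≤ C)
    (H-bound : ∀ M {x r} → x ≲ ℝ.1# → x ≲ r → H M x ≲ C ℝ.* r)
    (x : ℂ) (∣x∣<1 : ∣ x ∣< ℝ.1#) where

    xs ys : ℕ → ℂ
    xs p = ((G ∘ F) ^∘ p) x
    ys p = F (xs p)

    xs<1 : ∀ p → ∣ xs p ∣< ℝ.1#
    xs<1 zero    = ∣x∣<1
    xs<1 (suc p) = contracting-< {G} G≤ (contracting-< {F} F≤ (xs<1 p))

    ys<1 : ∀ p → ∣ ys p ∣< ℝ.1#
    ys<1 p = contracting-< {F} F≤ (xs<1 p)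

    -- A round trip through `F` and `G` gains θ²; one factor is given up, since the rate θ^p is all
    -- that is needed.
    xs≲ : ∀ p → xs p ≲ θ ℝ.^ p
    xs≲ zero    = ∣∣<⇒≲ ∣x∣<1
    xs≲ (suc p) = ≲-mono (ℝ.*-monoˡ-≤ 0≤θ (θr≤r (θ^-nonneg p)))
      (contracting-≲ {G} G≤ (ys<1 p) (contracting-≲ {F} F≤ (xs<1 p) (xs≲ p)))

    xs-suc≲ : ∀ p → xs (suc p) ≲ θ ℝ.^ p
    xs-suc≲ p = ≲-mono (θr≤r (θ^-nonneg p)) (xs≲ (suc p))

    2# 2D : ℝ.Carrier
    2# = ℝ.1# ℝ.+ ℝ.1#
    2D = 2# ℝ.* D

    0≤2 : ℝ.0# ≤ 2#
    0≤2 = ℝ.+-nonneg ℝ.0≤1 ℝ.0≤1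

    0≤2D : ℝ.0# ≤ 2D
    0≤2D = ℝ.*-nonneg 0≤2 0≤D

    term≲ : ∀ p → term F G x p ≲ 2# ℝ.* θ ℝ.^ p
    term≲ p = ≲-mono (ℝ.≤-reflexive (ℝ.solve 1 (λ t → con 1ℤ :* (t :+ t) := (con 1ℤ :+ con 1ℤ) :* t) ℝ.refl (θ ℝ.^ p)))
      (≲-* (∣∣<⇒≲ (ys<1 p)) (≲-- (xs≲ p) (xs-suc≲ p)))

    partial : ℕ → ℂ
    partial N = (∑< N) (term F G x)

    partial-suc : ∀ N → partial (suc N) ≈ partial N + term F G x N
    partial-suc N = ∑<-suc N (term F G x)

    partial-cauchy : ∀ m n → partial (m ℕ.+ n) - partial n ≲ 2D ℝ.* θ ℝ.^ n
    partial-cauchy = increments-≲ partial 2# 0≤2 λ n →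
      ≲-cong (sym (trans (+-congʳ (partial-suc n)) (x+y-x≈y (partial n) (term F G x n)))) (term≲ n)

    limit = converges partial 2D 0≤2D partial-cauchy

    s : ℂ
    s = proj₁ limit

    partial-s≲ : ∀ n → partial n - s ≲ (2D ℝ.+ ℝ.1#) ℝ.* θ ℝ.^ n
    partial-s≲ = proj₂ limit

    0≤2D+1 : ℝ.0# ≤ 2D ℝ.+ ℝ.1#
    0≤2D+1 = ℝ.+-nonneg 0≤2D ℝ.0≤1

    ∑term≈s : ∑ term F G x ≈ s
    ∑term≈s ε 0<ε = proj₁ null , λ n N≤n → ≲⇒∣∣< (partial-s≲ n) (proj₂ null n N≤n)
      where
      null = ℝ.geometric-null 0≤θ θ<1 0≤2D+1 0<ε

    module _ (M : ℕ) where
      -- With exact functional equations this would be constant in `P`. Its increments are therefore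
      -- differences of truncation errors at two curve points with common second coordinate `ys P`,
      -- and these are summable in `P`.
      g : ℕ → ℂ
      g P = partial P + H M (xs P)

      error≲ : ∀ P {w} → w ≲ ℝ.1# → w ≲ θ ℝ.^ P → e M w (ys P) ≲ θ ℝ.^ M ℝ.* θ ℝ.^ P
      error≲ P w≲1 w≲θ^P = ≲-mono (ℝ.≤-reflexive (ℝ.*-comm (θ ℝ.^ P) (θ ℝ.^ M)))
        (e-bound M w≲1 (∣∣<⇒≲ (ys<1 P)) w≲θ^P)

      g-increment : ∀ P → g (suc P) - g P ≲ (2# ℝ.* θ ℝ.^ M) ℝ.* θ ℝ.^ P
      g-increment P = ≲-cong
        (sym (trans (+-congʳ (+-congʳ (partial-suc P)))
          (step-error (F-equation M (xs P) (xs<1 P)) (G-equation M (ys P) (ys<1 P)))))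
        (≲-mono (ℝ.≤-reflexive (ℝ.solve 2 (λ m p → m :* p :+ m :* p := (con 1ℤ :+ con 1ℤ) :* m :* p)
            ℝ.refl (θ ℝ.^ M) (θ ℝ.^ P)))
          (≲-- (error≲ P (∣∣<⇒≲ (xs<1 P)) (xs≲ P)) (error≲ P (∣∣<⇒≲ (xs<1 (suc P))) (xs-suc≲ P))))

      g-M : g M - g 0 ≲ (2# ℝ.* θ ℝ.^ M) ℝ.* D ℝ.* ℝ.1#
      g-M = ≡.subst (λ k → g k - g 0 ≲ (2# ℝ.* θ ℝ.^ M) ℝ.* D ℝ.* ℝ.1#) (ℕ.+-identityʳ M)
        (increments-≲ g (2# ℝ.* θ ℝ.^ M) (ℝ.*-nonneg 0≤2 (θ^-nonneg M)) g-increment M 0)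

      -- Taking exactly `M` iterations makes all three pieces O(θ^M): the summed errors by their
      -- factor θ^M, the boundary term because `xs M` is that small, and the tail by the rate of
      -- convergence of the series.
      H-s≲ : H M x - s ≲ (2D ℝ.+ C ℝ.+ (2D ℝ.+ ℝ.1#)) ℝ.* θ ℝ.^ M
      H-s≲ = ≲-cong (limit-split (partial M) (H M x) (H M (xs M)) s)
        (≲-mono (ℝ.≤-reflexive (ℝ.solve 4 (λ two m D C →
            (two :* m) :* D :* con 1ℤ :+ C :* m :+ (two :* D :+ con 1ℤ) :* m
              := (two :* D :+ C :+ (two :* D :+ con 1ℤ)) :* m) ℝ.refl 2# (θ ℝ.^ M) D C))
          (≲-+ (≲-+ (≲-neg g-M) (H-bound M (∣∣<⇒≲ (xs<1 M)) (xs≲ M))) (partial-s≲ M)))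

    boundary-converges : ∃[ B ] (ℝ.0# ≤ B × (∀ M → H M x - s ≲ B ℝ.* θ ℝ.^ M))
    boundary-converges = 2D ℝ.+ C ℝ.+ (2D ℝ.+ ℝ.1#) , ℝ.+-nonneg (ℝ.+-nonneg 0≤2D 0≤C) 0≤2D+1 , H-s≲

-- Convergence of the generating function and the closed formulas.

module SingularWalks {ℓ ℓ₁ ℓ₂ ℓ₃} (R : Reals ℓ ℓ₁ ℓ₂ ℓ₃)
  (S : StepSet) (shape : SingularShape S) (ζ : Reals.Carrier R)
  (0<ζ : Reals._<_ R (Reals.0# R) ζ) (kζ<1 : Reals._<_ R (Reals._·_ R (length S) ζ) (Reals.1# R)) where
  open Walks R hiding (∑<_; sumList; _↑_)
  open ComplexBounds R
  open RootBounds R using (smallerRoot-onKernel; smallerRoot-bound)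
  open ℝ using (_≤_; _:=_; _:+_; _:*_; _:-_; :-_; con)

  z : ℂ
  z = fromℝ ζ

  θ : ℝ.Carrier
  θ = length S ℝ.· ζ

  0≤ζ : ℝ.0# ≤ ζ
  0≤ζ = ℝ.<⇒≤ 0<ζ

  0<nζ : ∀ n → ℝ.0# ℝ.< suc n ℝ.· ζ
  0<nζ n = ℝ.+-pos-nonneg 0<ζ (ℝ.·-nonneg n 0≤ζ)

  0<θ : ℝ.0# ℝ.< θ
  0<θ = positive shape
    where
    positive : ∀ {S} → SingularShape S → ℝ.0# ℝ.< length S ℝ.· ζ
    positive (nw∷se∷ {L} _) = 0<nζ (suc (length L))
    positive (se∷nw∷ {L} _) = 0<nζ (suc (length L))

  open Geometric θ 0<θ kζ<1
  open Monomials commutativeRing S z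
  open IterationIdentities commutativeRing
  open Algebra.Properties.Ring ring using (-0#≈0#)
  open Iteration R θ 0<θ kζ<1 using (Contracting)

  restrict-≲ : ∀ {f r} p → ℝ.0# ≤ r → (InQuadrant p → f p ≲ r) → restrict f p ≲ r
  restrict-≲ (+ _      , + _     ) 0≤r f≲r = f≲r (ℤ.+≤+ ℕ.z≤n , ℤ.+≤+ ℕ.z≤n)
  restrict-≲ (+ _      , -[1+ _ ]) 0≤r f≲r = 0≲ 0≤r
  restrict-≲ (-[1+ _ ] , _       ) 0≤r f≲r = 0≲ 0≤r

  sumList-≲ : ∀ (L : StepSet) {f r} → (∀ s → f s ≲ r) → sumList (map f L) ≲ length L ℝ.· r
  sumList-≲ []      f≲r = 0≲ ℝ.≤-refl
  sumList-≲ (s ∷ L) f≲r = ≲-+ (f≲r s) (sumList-≲ L f≲r)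

  E-≲ : ∀ {f} → (∀ {p} → InQuadrant p → f p ≲ ℝ.1#) → ∀ n p → E n f p ≲ θ ℝ.^ n
  E-≲ f≲1 zero    p = restrict-≲ p ℝ.0≤1 f≲1
  E-≲ f≲1 (suc n) p = restrict-≲ p (θ^-nonneg (suc n)) λ _ →
    ≲-mono (ℝ.≤-reflexive (ℝ.trans (ℝ.×-comm-* (length S) ζ (θ ℝ.^ n))
      (ℝ.sym (ℝ.×-assoc-* (length S) ζ (θ ℝ.^ n)))))
      (≲-* (≲-fromℝ 0≤ζ) (sumList-≲ S λ s → E-≲ f≲1 n (p ⊕ s)))

  ∑W : ℂ → ℂ → ℕ → ℂ
  ∑W x y N = (∑< N) (λ n → W n x y)

  Box : ℂ → ℂ → ℕ → ℕ → ℕ → ℂ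
  Box x y I J M = (∑< I) (λ i → (∑< J) (λ j → (∑< M) (λ n → q S i j n · (x ^ i * y ^ j * z ^ n))))

  geometric-≲ : ∀ (f : ℕ → ℂ) → (∀ n → f n ≲ θ ℝ.^ n) → ∀ m n →
    (∑< (m ℕ.+ n)) f - (∑< n) f ≲ ℝ.1# ℝ.* D ℝ.* θ ℝ.^ n
  geometric-≲ f f≲ = increments-≲ (λ N → (∑< N) f) ℝ.1# ℝ.0≤1 λ n →
    ≲-cong (sym (trans (+-congʳ (∑<-suc n f)) (x+y-x≈y ((∑< n) f) (f n))))
      (≲-mono (ℝ.≤-reflexive (ℝ.sym (ℝ.*-identityˡ _))) (f≲ n))

  module _ {x y : ℂ} (x≲1 : x ≲ ℝ.1#) (y≲1 : y ≲ ℝ.1#) where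

    monomial-≲ : ∀ p → monomial x y p ≲ ℝ.1#
    monomial-≲ (i , j) = ≲1-* (≲1-^ ℤ.∣ i ∣ x≲1) (≲1-^ ℤ.∣ j ∣ y≲1)

    W-≲ : ∀ n → W n x y ≲ θ ℝ.^ n
    W-≲ n = E-≲ (λ {p} _ → monomial-≲ p) n origin

    box-≲ : ∀ I J {p} → InQuadrant p → box x y I J p ≲ ℝ.1#
    box-≲ I J {p} p∈Q = [ (λ eq → ≲-cong (sym eq) (monomial-≲ p)) , (λ eq → ≲-cong (sym eq) (0≲ ℝ.0≤1)) ]′
      (box-value x y I J p∈Q)

    ∑W-≲ : ∀ M → ∑W x y M ≲ D
    ∑W-≲ M = ≲-cong (trans (+-congˡ -0#≈0#) (+-identityʳ (∑W x y M)))
      (≲-mono (ℝ.≤-reflexive (ℝ.solve 1 (λ D → con 1ℤ :* D :* con 1ℤ := D) ℝ.refl D))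
        (≡.subst (λ k → ∑W x y k - 0# ≲ ℝ.1# ℝ.* D ℝ.* ℝ.1#) (ℕ.+-identityʳ M) (geometric-≲ (λ n → W n x y) W-≲ M 0)))

    -- Lengths below `N` contribute exactly their `W`, because such walks stay in the box; the
    -- greater lengths form a geometric tail, bounded uniformly in `I` and `J`.
    Box-∑W≲ : ∀ {I J M N} → N ℕ.≤ I → N ℕ.≤ J → N ℕ.≤ M → Box x y I J M - ∑W x y N ≲ D ℝ.* θ ℝ.^ N
    Box-∑W≲ {I} {J} {M} {N} N≤I N≤J N≤M = ≲-cong
      (+-cong (sym (∑q≈∑E x y I J M)) (-‿cong (∑<-cong-< N λ n<N →
        E-box shape x y (ℕ.<-≤-trans n<N N≤I) (ℕ.<-≤-trans n<N N≤J))))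
      (≲-mono (ℝ.≤-reflexive (ℝ.*-congʳ (ℝ.*-identityˡ D)))
        (≡.subst (λ k → (∑< k) e - (∑< N) e ≲ ℝ.1# ℝ.* D ℝ.* θ ℝ.^ N) (ℕ.m∸n+n≡m N≤M)
          (geometric-≲ e (λ n → E-≲ (box-≲ I J) n origin) (M ℕ.∸ N) N)))
      where
      e : ℕ → ℂ
      e n = E n (box x y I J) origin

    -- Reduces independent convergence in `I`, `J` and `M` to one sequence of partial sums. Only
    -- nonempty sums are constrained: at the origin the empty sum is 0 while all others already have
    -- the limiting value.
    Q-value : ∀ {v B} → ℝ.0# ≤ B → (∀ N → ∑W x y (suc N) - v ≲ B ℝ.* θ ℝ.^ suc N) →
      Q[ S ]⟨ x , y , z ⟩≈ v
    Q-value {v} {B} 0≤B ∑W-v≲ ε 0<ε = suc N , λ I J M N<I N<J N<M → ≲⇒∣∣<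
      (≲-cong (+-telescope v (∑W x y (suc N)) (Box x y I J M))
        (≲-mono (ℝ.≤-reflexive (ℝ.sym (ℝ.distribʳ (θ ℝ.^ suc N) B D)))
          (≲-+ (∑W-v≲ N) (Box-∑W≲ N<I N<J N<M))))
      (proj₂ null (suc N) (ℕ.n≤1+n N))
      where
      open RingIdentities commutativeRing
      null = ℝ.geometric-null 0≤θ kζ<1 (ℝ.+-nonneg 0≤B 0≤D) 0<ε
      N = proj₁ null

    error-≲ : ∀ M {u v r} → u ≲ r → v ≲ ℝ.1# → (u * v) * W M x y ≲ r ℝ.* θ ℝ.^ M
    error-≲ M u≲r v≲1 = ≲-mono (ℝ.≤-reflexive (ℝ.*-congʳ (ℝ.*-identityʳ _))) (≲-* (≲-* u≲r v≲1) (W-≲ M))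

    boundary-≲ : ∀ M {w r} → w ≲ ℝ.1# → w ≲ r → z * w ^ 2 * ∑W x y M ≲ ζ ℝ.* D ℝ.* r
    boundary-≲ M {w} {r} w≲1 w≲r = ≲-mono
      (ℝ.≤-reflexive (ℝ.solve 3 (λ ζ r D → ζ :* (r :* (con 1ℤ :* con 1ℤ)) :* D := ζ :* D :* r) ℝ.refl ζ r D))
      (≲-* (≲-* (≲-fromℝ 0≤ζ) (≲-* w≲r (≲-* w≲1 1≲1))) (∑W-≲ M))

  0≲1 : 0# ≲ ℝ.1#
  0≲1 = 0≲ ℝ.0≤1

  HX HY : ℕ → ℂ → ℂ
  HX M x = z * x ^ 2 * ∑W x 0# M
  HY M y = z * y ^ 2 * ∑W 0# y M

  kernel-equation : ∀ M x y → z * stepPolynomial S x y ≈ x * y →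
    HX M x + HY M y + (x * y) * W M x y ≈ x * y
  kernel-equation M x y onKernel = truncated-equation shape x y onKernel M

  -- Multiplication by the inverse `r` turns the limit of the boundary term into one for the
  -- generating function; the loss is the constant factor `1# + ∣ r ∣²`, a bound on |r|.
  boundary-limit : ∀ {x y w r s B} → x ≲ ℝ.1# → y ≲ ℝ.1# → r ≈1/ (z * w ^ 2) → ℝ.0# ≤ B →
    (∀ M → z * w ^ 2 * ∑W x y M - s ≲ B ℝ.* θ ℝ.^ M) → Q[ S ]⟨ x , y , z ⟩≈ (r * s)
  boundary-limit {x} {y} {w} {r} {s} {B} x≲1 y≲1 r≈1/ 0≤B H-s≲ = Q-value x≲1 y≲1
    (ℝ.*-nonneg 0≤r 0≤B) λ N → ≲-cong
      (trans (sym (+-identityˡ _)) (trans (+-congʳ (sym (-‿inverseʳ (∑W x y (suc N)))))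
        (rescale r≈1/ (∑W x y (suc N)) (∑W x y (suc N)) s)))
      (≲-mono (ℝ.≤-reflexive (ℝ.sym (ℝ.*-assoc (ℝ.1# ℝ.+ ∣ r ∣²) B (θ ℝ.^ suc N))))
        (≲-* (≲-self r) (H-s≲ (suc N))))
    where
    0≤r : ℝ.0# ≤ ℝ.1# ℝ.+ ∣ r ∣²
    0≤r = ℝ.+-nonneg ℝ.0≤1 (∣∣²-nonneg r)

  inverse : ∀ {w} → Nonzero w → ∃[ u ] (u ≈1/ w)
  inverse {w@(a +i b)} 0<∣w∣² = (a ℝ.* m) +i (ℝ.- b ℝ.* m)
    , ℝ.trans (ℝ.solve 3 (λ a b m → a :* m :* a :- (:- b :* m) :* b := (a :* a :+ b :* b) :* m)
        ℝ.refl a b m) (proj₂ (proj₂ m-inverse))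
    , ℝ.solve 3 (λ a b m → a :* m :* b :+ (:- b :* m) :* a := con 0ℤ) ℝ.refl a b m
    where
    m-inverse = ℝ.pos-inverse 0<∣w∣²
    m = proj₁ m-inverse

  z-nonzero : Nonzero z
  z-nonzero = ℝ.+-pos-nonneg (ℝ.*-pos 0<ζ 0<ζ) (ℝ.x²-nonneg ℝ.0#)

  zw²-inverse : ∀ {w} → Nonzero w → ∃[ r ] (r ≈1/ (z * w ^ 2))
  zw²-inverse {w} w≠0 = r * (u * u) , *-inverse {r} {z} {u} {w} rz≈1 uw≈1
    where
    r u : ℂ
    r = proj₁ (inverse z-nonzero)
    u = proj₁ (inverse w≠0)
    rz≈1 : r * z ≈ 1#
    rz≈1 = proj₂ (inverse z-nonzero)
    uw≈1 : u * w ≈ 1#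
    uw≈1 = proj₂ (inverse w≠0)

  module _ (X₀ Y₀ : ℂ → ℂ) (isX₀ : IsX₀ S z X₀) (isY₀ : IsY₀ S z Y₀) where

    kζ<1′ : length (exchange S) ℝ.· ζ ℝ.< ℝ.1#
    kζ<1′ = ≡.subst (λ k → k ℝ.· ζ ℝ.< ℝ.1#) (≡.sym (length-map swap S)) kζ<1

    X₀-contracting : Contracting X₀
    X₀-contracting y ∣y∣<1 = ≡.subst
      (λ k → ∣ X₀ y ∣² ≤ ((k ℝ.· ζ) ℝ.* (k ℝ.· ζ)) ℝ.* ∣ y ∣²) (length-map swap S)
      (smallerRoot-bound (exchange-shape shape) 0<ζ kζ<1′ (∣∣<⇒≲ ∣y∣<1) (isX₀ y ∣y∣<1))

    Y₀-contracting : Contracting Y₀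
    Y₀-contracting x ∣x∣<1 = smallerRoot-bound shape 0<ζ kζ<1 (∣∣<⇒≲ ∣x∣<1) (isY₀ x ∣x∣<1)

    Y₀-onKernel : ∀ x → ∣ x ∣< ℝ.1# → z * stepPolynomial S x (Y₀ x) ≈ x * Y₀ x
    Y₀-onKernel x ∣x∣<1 = smallerRoot-onKernel shape 0<ζ kζ<1 (∣∣<⇒≲ ∣x∣<1) (isY₀ x ∣x∣<1)

    -- `X₀` is the smaller root for the exchanged set; commuting the two powers in each summand
    -- returns its kernel equation to `S` with the arguments swapped.
    X₀-onKernel : ∀ y → ∣ y ∣< ℝ.1# → z * stepPolynomial S (X₀ y) y ≈ X₀ y * y
    X₀-onKernel y ∣y∣<1 = trans (*-congˡ (trans
      (sumList-cong S λ {s} _ → *-comm (X₀ y ↑ proj₁ s) (y ↑ proj₂ s))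
      (sym (sumList-exchange (λ (i , j) → y ↑ i * X₀ y ↑ j) S))))
      (trans (smallerRoot-onKernel (exchange-shape shape) 0<ζ kζ<1′ (∣∣<⇒≲ ∣y∣<1) (isX₀ y ∣y∣<1))
        (*-comm y (X₀ y)))

    0≤ζD : ℝ.0# ≤ ζ ℝ.* D
    0≤ζD = ℝ.*-nonneg 0≤ζ 0≤D

    error : ℕ → ℂ → ℂ → ℂ
    error M x y = x * y * W M x y

    Y₀-equation : ∀ M x → ∣ x ∣< ℝ.1# → HX M x + HY M (Y₀ x) + error M x (Y₀ x) ≈ x * Y₀ x
    Y₀-equation M x ∣x∣<1 = kernel-equation M x (Y₀ x) (Y₀-onKernel x ∣x∣<1)

    X₀-equation : ∀ M y → ∣ y ∣< ℝ.1# → HX M (X₀ y) + HY M y + error M (X₀ y) y ≈ X₀ y * y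
    X₀-equation M y ∣y∣<1 = kernel-equation M (X₀ y) y (X₀-onKernel y ∣y∣<1)

    error-≲ˣ : ∀ M {x y r} → x ≲ ℝ.1# → y ≲ ℝ.1# → x ≲ r → error M x y ≲ r ℝ.* θ ℝ.^ M
    error-≲ˣ M x≲1 y≲1 x≲r = error-≲ x≲1 y≲1 M x≲r y≲1

    error-≲ʸ : ∀ M {y x r} → y ≲ ℝ.1# → x ≲ ℝ.1# → y ≲ r → error M x y ≲ r ℝ.* θ ℝ.^ M
    error-≲ʸ M {y} {x} y≲1 x≲1 y≲r = ≲-cong (*-congʳ (*-comm y x)) (error-≲ x≲1 y≲1 M y≲r x≲1)

    HX-≲ : ∀ M {x r} → x ≲ ℝ.1# → x ≲ r → HX M x ≲ ζ ℝ.* D ℝ.* r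
    HX-≲ M x≲1 x≲r = boundary-≲ x≲1 0≲1 M x≲1 x≲r

    HY-≲ : ∀ M {y r} → y ≲ ℝ.1# → y ≲ r → HY M y ≲ ζ ℝ.* D ℝ.* r
    HY-≲ M y≲1 y≲r = boundary-≲ 0≲1 y≲1 M y≲1 y≲r

    module SeriesY₀ = Iteration.Series R θ 0<θ kζ<1 Y₀ X₀ Y₀-contracting X₀-contracting
      HX HY error Y₀-equation X₀-equation error-≲ˣ (ζ ℝ.* D) 0≤ζD HX-≲

    -- The second formula is the same telescoping argument with the two boundary terms, the two
    -- roots and the order of the arguments exchanged.
    module SeriesX₀ = Iteration.Series R θ 0<θ kζ<1 X₀ Y₀ X₀-contracting Y₀-contracting
      HY HX (λ M y x → error M x y)
      (λ M y ∣y∣<1 → exchange-halves {HX M (X₀ y)} {HY M y} (X₀-equation M y ∣y∣<1))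
      (λ M x ∣x∣<1 → exchange-halves {HX M x} {HY M (Y₀ x)} (Y₀-equation M x ∣x∣<1))
      error-≲ʸ (ζ ℝ.* D) 0≤ζD HY-≲

    Q[x,0] : ∀ x → ∣ x ∣< ℝ.1# → Nonzero x →
      ∃[ r ] ∃[ s ] (r ≈1/ (z * x ^ 2)) × (∑ term Y₀ X₀ x ≈ s) × (Q[ S ]⟨ x , 0# , z ⟩≈ (r * s))
    Q[x,0] x ∣x∣<1 x≠0 = proj₁ r-inverse , SeriesY₀.s x ∣x∣<1
      , proj₂ r-inverse , SeriesY₀.∑term≈s x ∣x∣<1
      , boundary-limit {w = x} (∣∣<⇒≲ ∣x∣<1) 0≲1 (proj₂ r-inverse)
          (proj₁ (proj₂ bounded)) (proj₂ (proj₂ bounded))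
      where
      r-inverse = zw²-inverse x≠0
      bounded = SeriesY₀.boundary-converges x ∣x∣<1

    Q[0,y] : ∀ y → ∣ y ∣< ℝ.1# → Nonzero y →
      ∃[ r ] ∃[ s ] (r ≈1/ (z * y ^ 2)) × (∑ term X₀ Y₀ y ≈ s) × (Q[ S ]⟨ 0# , y , z ⟩≈ (r * s))
    Q[0,y] y ∣y∣<1 y≠0 = proj₁ r-inverse , SeriesX₀.s y ∣y∣<1
      , proj₂ r-inverse , SeriesX₀.∑term≈s y ∣y∣<1
      , boundary-limit {w = y} 0≲1 (∣∣<⇒≲ ∣y∣<1) (proj₂ r-inverse)
          (proj₁ (proj₂ bounded)) (proj₂ (proj₂ bounded))
      where
      r-inverse = zw²-inverse y≠0
      bounded = SeriesX₀.boundary-converges y ∣y∣<1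

  ∑W-origin : ∀ N → ∑W 0# 0# (suc N) ≈ 1#
  ∑W-origin N = trans (+-cong (W-zero 0# 0#) (trans (∑<-cong N (W-origin shape)) (∑<-zero N))) (+-identityʳ 1#)

  -- The value is 1 rather than 0: the empty walk is counted by `q`, and by `W-origin` no longer
  -- walk ends at the origin. From the first partial sum on the error is zero, so `B` is `0#`.
  Q[0,0] : Q[ S ]⟨ 0# , 0# , z ⟩≈ 1#
  Q[0,0] = Q-value 0≲1 0≲1 ℝ.≤-refl λ N →
    ≲-cong (sym (trans (+-congʳ (∑W-origin N)) (-‿inverseʳ 1#)))
      (0≲ (ℝ.*-nonneg ℝ.≤-refl (θ^-nonneg (suc N))))

theorem4 : ∀ {ℓ ℓ₁ ℓ₂ ℓ₃} (R : Reals ℓ ℓ₁ ℓ₂ ℓ₃) →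
    let module ℝ = Reals R
        open Walks R
    in
    (S : StepSet) → Singular S →
    (ζ : ℝ.Carrier) → ℝ.0# ℝ.< ζ → length S ℝ.· ζ ℝ.< ℝ.1# →
    let z = fromℝ ζ in
    (X₀ Y₀ : ℂ → ℂ) → IsX₀ S z X₀ → IsY₀ S z Y₀ →
    (∀ x → ∣ x ∣< ℝ.1# → Nonzero x →
       ∃[ r ] ∃[ s ] (r ≈1/ (z * x ^ 2)) × (∑ term Y₀ X₀ x ≈ s) × (Q[ S ]⟨ x , 0# , z ⟩≈ (r * s)))
    ×
    (∀ y → ∣ y ∣< ℝ.1# → Nonzero y →
       ∃[ r ] ∃[ s ] (r ≈1/ (z * y ^ 2)) × (∑ term X₀ Y₀ y ≈ s) × (Q[ S ]⟨ 0# , y , z ⟩≈ (r * s)))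
    ×
    (Q[ S ]⟨ 0# , 0# , z ⟩≈ 1#)
theorem4 R S singular ζ 0<ζ kζ<1 X₀ Y₀ isX₀ isY₀ =
  Q[x,0] X₀ Y₀ isX₀ isY₀ , Q[0,y] X₀ Y₀ isX₀ isY₀ , Q[0,0]
  where
  open SingularWalks R S (singular⇒shape singular) ζ 0<ζ kζ<1
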